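{- Let $q\in\{2,3,5,7,11\}$ and let $G$ be a subgroup of $\mathrm{SL}_2(q)$ acting sharply transitively on the non-zero vectors of $\mathbb{F}_q^2$, where $G\cong\mathrm{GL}_1(4)$ if $q=2$, $G\cong Q_8$ if $q=3$, $G\cong 2.\mathrm{A}_4$ if $q=5$, $G\cong 2.\mathrm{S}_4$ if $q=7$, and $G\cong \mathrm{SL}_2(5)$ if $q=11$. Let $V=\mathbb{F}_q^4$ be equipped with the symplectic form $f(x,y)=x_1y_2-x_2y_1-x_3y_4+x_4y_3$, which defines $\mathsf{W}_3(q)$, and let $$C=\{\,\text{row space of } [\,I\mid A\,] : A\in G\,\},$$ where $I$ is the $2\times 2$ identity matrix and $[\,I\mid A\,]$ is the $2\times 4$ matrix with blocks $I$ and $A$. Then $C$ is a neighbour-transitive maximal partial spread of $\mathsf{W}_3(q)$.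
   Context: $\mathsf{W}_3(q)$: the points are the $1$-dimensional subspaces of $V$, the lines are the totally isotropic $2$-dimensional subspaces of $V$ with respect to $f$, incidence is symmetrised containment. Its point-line incidence graph $\varGamma$ has all points and lines as vertices, with adjacency given by incidence. A partial spread is a set of lines such that each point is incident with at most one line of the set; it is maximal if it is not properly contained in another partial spread. A code $C$ is a subset of the vertex set of $\varGamma$; $C_1$ is the set of vertices not in $C$ that are adjacent to some element of $C$; $\operatorname{Aut}(C)$ is the setwise stabiliser of $C$ in $\operatorname{Aut}(\varGamma)$; $C$ is neighbour-transitive if $\operatorname{Aut}(C)$ acts transitively on each of $C$ and $C_1$. Here $2.\mathrm{A}_4$ and $2.\mathrm{S}_4$ denote the double covers of $\mathrm{A}_4$ and $\mathrm{S}_4$ (of orders $24$ and $48$) occurring as subgroups of $\mathrm{SL}_2(5)$ and $\mathrm{SL}_2(7)$ respectively; in every case $|G|=q^2-1$. -}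

module Defs where

open import Algebra.Bundles using (CommutativeRing; Group)
open import Algebra.Morphism.Structures using (module GroupMorphisms)
import Algebra.Properties.CommutativeSemigroup as CommutativeSemigroupProperties
import Algebra.Properties.Semiring.Sum as SemiringSum
open import Data.Fin.Base using (zero; suc)
open import Data.Fin.Patterns using (0F; 1F; 2F; 3F)
open import Data.Fin.Permutation as Perm using (Permutation′; _⟨$⟩ʳ_; _⟨$⟩ˡ_; _∘ₚ_; transpose)
import Data.Fin.Permutation.Components as PC
open import Data.Fin.Permutation.Transposition.List using (TranspositionList; eval)
open import Data.Integer.Base as ℤ using (ℤ; +_)
import Data.Integer.Divisibility.Signed as ℤ
import Data.Integer.Properties as ℤ
open import Data.Integer.Tactic.RingSolver using (solve-∀)
open import Data.List.Base as List using ([]; _∷_; length)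
import Data.List.Properties as List
open import Data.List.Relation.Unary.All as All using (All)
import Data.List.Relation.Unary.All.Properties as All
open import Data.Nat.Base as ℕ using (ℕ)
import Data.Nat.Divisibility as ℕ
open import Data.Product using (∃; ∃!; ∃-syntax; Σ-syntax; _×_; _,_; proj₁; proj₂)
open import Data.Product.Properties using (≡-dec)
open import Data.Sign.Base as Sign using (Sign)
import Data.Sign.Properties as Sign
open import Data.Sum.Base using (_⊎_; inj₁; inj₂)
open import Data.Vec.Functional using (Vector; _++_)
import Data.Vec.Functional.Relation.Binary.Equality.Setoid as VectorEquality
open import Function.Base using (_∘_; _on_)
open import Function.Bundles using (Inverse; _⇔_)
open import Function.Definitions using (Surjective)
open import Level using (Level; 0ℓ; _⊔_) renaming (suc to lsuc)
open import Relation.Binary.Bundles using (Setoid)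
open import Relation.Binary.Core using (Rel)
open import Relation.Binary.Definitions using (DecidableEquality; _Respects_)
import Relation.Binary.Construct.On as On
open import Relation.Binary.PropositionalEquality as ≡ using (_≡_; _≢_)
open import Relation.Nullary.Decidable using (Dec; yes; no; map′; _×-dec_; from-yes)
open import Relation.Nullary.Negation using (¬_)
open import Relation.Unary using (Pred; Decidable; _∈_; _⊆_; _≐_)
open import Relation.Unary.Properties using (≐-refl; ≐-sym; ≐-trans)

private
  variable
    k m n : ℕ

------------------------------------------------------------------------
-- The field of prime order q, as the setoid of integers modulo q

module _ (q : ℕ) where

  infix 4 _≈[mod]_

  record _≈[mod]_ (x y : ℤ) : Set where
    constructor mod
    field divisible : + q ℤ.∣ x ℤ.- y

  open _≈[mod]_

  private
    reflexive : ∀ {x y} → x ≡ y → x ≈[mod] y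
    reflexive {x} ≡.refl = mod (ℤ.divides (+ 0) (ℤ.+-inverseʳ x))

    via : ∀ {x y z} → z ≡ x ℤ.- y → + q ℤ.∣ z → x ≈[mod] y
    via ≡.refl = mod

    sym : ∀ {x y} → x ≈[mod] y → y ≈[mod] x
    sym {x} {y} (mod p) = via (lemma x y) (ℤ.∣m⇒∣-m p)
      where
      lemma : ∀ x y → ℤ.- (x ℤ.- y) ≡ y ℤ.- x
      lemma = solve-∀

    trans : ∀ {x y z} → x ≈[mod] y → y ≈[mod] z → x ≈[mod] z
    trans {x} {y} {z} (mod p) (mod r) = via (lemma x y z) (ℤ.∣m∣n⇒∣m+n p r)
      where
      lemma : ∀ x y z → (x ℤ.- y) ℤ.+ (y ℤ.- z) ≡ x ℤ.- z
      lemma = solve-∀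

    +-cong : ∀ {x x′ y y′} → x ≈[mod] x′ → y ≈[mod] y′ → x ℤ.+ y ≈[mod] x′ ℤ.+ y′
    +-cong {x} {x′} {y} {y′} (mod p) (mod r) = via (lemma x x′ y y′) (ℤ.∣m∣n⇒∣m+n p r)
      where
      lemma : ∀ x x′ y y′ → (x ℤ.- x′) ℤ.+ (y ℤ.- y′) ≡ (x ℤ.+ y) ℤ.- (x′ ℤ.+ y′)
      lemma = solve-∀

    *-cong : ∀ {x x′ y y′} → x ≈[mod] x′ → y ≈[mod] y′ → x ℤ.* y ≈[mod] x′ ℤ.* y′
    *-cong {x} {x′} {y} {y′} (mod p) (mod r) =
      via (lemma x x′ y y′) (ℤ.∣m∣n⇒∣m+n (ℤ.∣m⇒∣m*n y p) (ℤ.∣n⇒∣m*n x′ r))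
      where
      lemma : ∀ x x′ y y′ → (x ℤ.- x′) ℤ.* y ℤ.+ x′ ℤ.* (y ℤ.- y′) ≡ (x ℤ.* y) ℤ.- (x′ ℤ.* y′)
      lemma = solve-∀

    neg-cong : ∀ {x y} → x ≈[mod] y → ℤ.- x ≈[mod] ℤ.- y
    neg-cong {x} {y} (mod p) = via (lemma x y) (ℤ.∣m⇒∣-m p)
      where
      lemma : ∀ x y → ℤ.- (x ℤ.- y) ≡ (ℤ.- x) ℤ.- (ℤ.- y)
      lemma = solve-∀

  𝔽 : CommutativeRing 0ℓ 0ℓ
  𝔽 = record
    { Carrier = ℤ ; _≈_ = _≈[mod]_
    ; _+_ = ℤ._+_ ; _*_ = ℤ._*_ ; -_ = ℤ.-_ ; 0# = + 0 ; 1# = + 1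
    ; isCommutativeRing = record
      { isRing = record
        { +-isAbelianGroup = record
          { isGroup = record
            { isMonoid = record
              { isSemigroup = record
                { isMagma = record
                  { isEquivalence = record { refl = reflexive ≡.refl ; sym = sym ; trans = trans }
                  ; ∙-cong = +-cong
                  }
                ; assoc = λ x y z → reflexive (ℤ.+-assoc x y z)
                }
              ; identity = (λ x → reflexive (ℤ.+-identityˡ x)) , (λ x → reflexive (ℤ.+-identityʳ x))
              }
            ; inverse = (λ x → reflexive (ℤ.+-inverseˡ x)) , (λ x → reflexive (ℤ.+-inverseʳ x))
            ; ⁻¹-cong = neg-cong
            }
          ; comm = λ x y → reflexive (ℤ.+-comm x y)
          }
        ; *-cong = *-cong
        ; *-assoc = λ x y z → reflexive (ℤ.*-assoc x y z)
        ; *-identity = (λ x → reflexive (ℤ.*-identityˡ x)) , (λ x → reflexive (ℤ.*-identityʳ x))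
        ; distrib = (λ x y z → reflexive (ℤ.*-distribˡ-+ x y z)) , (λ x y z → reflexive (ℤ.*-distribʳ-+ x y z))
        }
      ; *-comm = λ x y → reflexive (ℤ.*-comm x y)
      }
    }

------------------------------------------------------------------------
-- The field of order 4, as 𝔽₂[ω] with ω² = - ω - 1; the pair (a , b)
-- stands for a + b ω

module _ where

  open CommutativeRing (𝔽 2)

  𝔽₄ : CommutativeRing 0ℓ 0ℓ
  𝔽₄ = record
    { Carrier = Carrier × Carrier
    ; _≈_ = λ (a , b) (c , d) → a ≈ c × b ≈ d
    ; _+_ = λ (a , b) (c , d) → a + c , b + d
    ; _*_ = λ (a , b) (c , d) → a * c - b * d , a * d + b * c - b * d
    ; -_ = λ (a , b) → - a , - b
    ; 0# = 0# , 0#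
    ; 1# = 1# , 0#
    ; isCommutativeRing = record
      { isRing = record
        { +-isAbelianGroup = record
          { isGroup = record
            { isMonoid = record
              { isSemigroup = record
                { isMagma = record
                  { isEquivalence = record
                    { refl = refl , refl
                    ; sym = λ (p , r) → sym p , sym r
                    ; trans = λ (p , r) (p′ , r′) → trans p p′ , trans r r′
                    }
                  ; ∙-cong = λ (p , r) (p′ , r′) → +-cong p p′ , +-cong r r′
                  }
                ; assoc = λ (a , b) (c , d) (e , f) → +-assoc a c e , +-assoc b d f
                }
              ; identity = (λ (a , b) → +-identityˡ a , +-identityˡ b)
                         , (λ (a , b) → +-identityʳ a , +-identityʳ b)
              }
            ; inverse = (λ (a , b) → -‿inverseˡ a , -‿inverseˡ b)
                      , (λ (a , b) → -‿inverseʳ a , -‿inverseʳ b)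
            ; ⁻¹-cong = λ (p , r) → -‿cong p , -‿cong r
            }
          ; comm = λ (a , b) (c , d) → +-comm a c , +-comm b d
          }
        ; *-cong = λ (p , r) (p′ , r′) →
            +-cong (*-cong p p′) (-‿cong (*-cong r r′)) ,
            +-cong (+-cong (*-cong p r′) (*-cong r p′)) (-‿cong (*-cong r r′))
        ; *-assoc = λ (a , b) (c , d) (e , f) →
            reflexive (assoc₁ a b c d e f) , reflexive (assoc₂ a b c d e f)
        ; *-identity = (λ (a , b) → reflexive (idˡ₁ a b) , reflexive (idˡ₂ a b))
                     , (λ (a , b) → reflexive (idʳ₁ a b) , reflexive (idʳ₂ a b))
        ; distrib = (λ (a , b) (c , d) (e , f) →
                       reflexive (distˡ₁ a b c d e f) , reflexive (distˡ₂ a b c d e f))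
                  , (λ (a , b) (c , d) (e , f) →
                       reflexive (distʳ₁ a b c d e f) , reflexive (distʳ₂ a b c d e f))
        }
      ; *-comm = λ (a , b) (c , d) → reflexive (comm₁ a b c d) , reflexive (comm₂ a b c d)
      }
    }
    where
    assoc₁ : ∀ a b c d e f →
      (a ℤ.* c ℤ.- b ℤ.* d) ℤ.* e ℤ.- (a ℤ.* d ℤ.+ b ℤ.* c ℤ.- b ℤ.* d) ℤ.* f ≡
      a ℤ.* (c ℤ.* e ℤ.- d ℤ.* f) ℤ.- b ℤ.* (c ℤ.* f ℤ.+ d ℤ.* e ℤ.- d ℤ.* f)
    assoc₁ = solve-∀
    assoc₂ : ∀ a b c d e f →
      (a ℤ.* c ℤ.- b ℤ.* d) ℤ.* f ℤ.+ (a ℤ.* d ℤ.+ b ℤ.* c ℤ.- b ℤ.* d) ℤ.* e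
        ℤ.- (a ℤ.* d ℤ.+ b ℤ.* c ℤ.- b ℤ.* d) ℤ.* f ≡
      a ℤ.* (c ℤ.* f ℤ.+ d ℤ.* e ℤ.- d ℤ.* f) ℤ.+ b ℤ.* (c ℤ.* e ℤ.- d ℤ.* f)
        ℤ.- b ℤ.* (c ℤ.* f ℤ.+ d ℤ.* e ℤ.- d ℤ.* f)
    assoc₂ = solve-∀
    idˡ₁ : ∀ a b → + 1 ℤ.* a ℤ.- + 0 ℤ.* b ≡ a
    idˡ₁ = solve-∀
    idˡ₂ : ∀ a b → + 1 ℤ.* b ℤ.+ + 0 ℤ.* a ℤ.- + 0 ℤ.* b ≡ b
    idˡ₂ = solve-∀
    idʳ₁ : ∀ a b → a ℤ.* + 1 ℤ.- b ℤ.* + 0 ≡ a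
    idʳ₁ = solve-∀
    idʳ₂ : ∀ a b → a ℤ.* + 0 ℤ.+ b ℤ.* + 1 ℤ.- b ℤ.* + 0 ≡ b
    idʳ₂ = solve-∀
    distˡ₁ : ∀ a b c d e f →
      a ℤ.* (c ℤ.+ e) ℤ.- b ℤ.* (d ℤ.+ f) ≡ (a ℤ.* c ℤ.- b ℤ.* d) ℤ.+ (a ℤ.* e ℤ.- b ℤ.* f)
    distˡ₁ = solve-∀
    distˡ₂ : ∀ a b c d e f →
      a ℤ.* (d ℤ.+ f) ℤ.+ b ℤ.* (c ℤ.+ e) ℤ.- b ℤ.* (d ℤ.+ f) ≡
      (a ℤ.* d ℤ.+ b ℤ.* c ℤ.- b ℤ.* d) ℤ.+ (a ℤ.* f ℤ.+ b ℤ.* e ℤ.- b ℤ.* f)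
    distˡ₂ = solve-∀
    distʳ₁ : ∀ a b c d e f →
      (c ℤ.+ e) ℤ.* a ℤ.- (d ℤ.+ f) ℤ.* b ≡ (c ℤ.* a ℤ.- d ℤ.* b) ℤ.+ (e ℤ.* a ℤ.- f ℤ.* b)
    distʳ₁ = solve-∀
    distʳ₂ : ∀ a b c d e f →
      (c ℤ.+ e) ℤ.* b ℤ.+ (d ℤ.+ f) ℤ.* a ℤ.- (d ℤ.+ f) ℤ.* b ≡
      (c ℤ.* b ℤ.+ d ℤ.* a ℤ.- d ℤ.* b) ℤ.+ (e ℤ.* b ℤ.+ f ℤ.* a ℤ.- f ℤ.* b)
    distʳ₂ = solve-∀
    comm₁ : ∀ a b c d → a ℤ.* c ℤ.- b ℤ.* d ≡ c ℤ.* a ℤ.- d ℤ.* b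
    comm₁ = solve-∀
    comm₂ : ∀ a b c d →
      a ℤ.* d ℤ.+ b ℤ.* c ℤ.- b ℤ.* d ≡ c ℤ.* b ℤ.+ d ℤ.* a ℤ.- d ℤ.* b
    comm₂ = solve-∀

------------------------------------------------------------------------
-- Groups

infix 4 _≅_ _IsDoubleCoverOf_

_≅_ : Group 0ℓ 0ℓ → Group 0ℓ 0ℓ → Set
G ≅ H = ∃ (GroupMorphisms.IsGroupIsomorphism (Group.rawGroup G) (Group.rawGroup H))

record Subgroup (G : Group 0ℓ 0ℓ) : Set₁ where
  open Group G
  field
    Member    : Pred Carrier 0ℓ
    resp      : Member Respects _≈_
    ε-closed  : ε ∈ Member
    ∙-closed  : ∀ {x y} → x ∈ Member → y ∈ Member → x ∙ y ∈ Member
    ⁻¹-closed : ∀ {x} → x ∈ Member → x ⁻¹ ∈ Member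

  group : Group 0ℓ 0ℓ
  group = record
    { Carrier = ∃ Member
    ; _≈_ = _≈_ on proj₁
    ; _∙_ = λ (x , x∈) (y , y∈) → x ∙ y , ∙-closed x∈ y∈
    ; ε = ε , ε-closed
    ; _⁻¹ = λ (x , x∈) → x ⁻¹ , ⁻¹-closed x∈
    ; isGroup = record
      { isMonoid = record
        { isSemigroup = record
          { isMagma = record
            { isEquivalence = On.isEquivalence proj₁ isEquivalence
            ; ∙-cong = ∙-cong
            }
          ; assoc = λ (x , _) (y , _) (z , _) → assoc x y z
          }
        ; identity = (λ (x , _) → identityˡ x) , (λ (x , _) → identityʳ x)
        }
      ; inverse = (λ (x , _) → inverseˡ x) , (λ (x , _) → inverseʳ x)
      ; ⁻¹-cong = ⁻¹-cong
      }
    }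

-- Products of commutators are closed under inversion, since
-- [x , y]⁻¹ = [y , x].
data Derived (G : Group 0ℓ 0ℓ) : Pred (Group.Carrier G) 0ℓ where
  commutator : ∀ x y → let open Group G in x ∙ y ∙ x ⁻¹ ∙ y ⁻¹ ∈ Derived G
  identity   : Group.ε G ∈ Derived G
  product    : ∀ {x y} → x ∈ Derived G → y ∈ Derived G → Group._∙_ G x y ∈ Derived G
  respects   : Derived G Respects Group._≈_ G

-- H is a double cover 2.X of X: a central extension of X by a group of
-- order two that lies in the derived subgroup (so that H is non-split).
-- S₄ has two such covers up to isomorphism. SL₂(7) has a unique
-- involution, so only the binary octahedral group occurs as a subgroup of
-- it; for a subgroup of SL₂(7), being a double cover of S₄ thus pins down
-- the isomorphism type.
record _IsDoubleCoverOf_ (H X : Group 0ℓ 0ℓ) : Set where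
  private
    module H = Group H
    module X = Group X
  field
    ⟦_⟧         : H.Carrier → X.Carrier
    isHom       : GroupMorphisms.IsGroupHomomorphism H.rawGroup X.rawGroup ⟦_⟧
    surjective  : Surjective H._≈_ X._≈_ ⟦_⟧
    z           : H.Carrier
    z≉ε         : ¬ z H.≈ H.ε
    kernel      : ∀ h → (⟦ h ⟧ X.≈ X.ε) ⇔ (h H.≈ H.ε ⊎ h H.≈ z)
    z-central   : ∀ h → z H.∙ h H.≈ h H.∙ z
    z-derived   : z ∈ Derived H

-- GL₁ R is the group of units of R, a 1 × 1 matrix being identified with
-- its entry.
module _ (R : CommutativeRing 0ℓ 0ℓ) where

  open CommutativeRing R
  open CommutativeSemigroupProperties *-commutativeSemigroup using (interchange)

  record Unit : Set where
    constructor unit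
    field
      value   : Carrier
      inv     : Carrier
      inverse : value * inv ≈ 1#

  open Unit

  GL₁ : Group 0ℓ 0ℓ
  GL₁ = record
    { Carrier = Unit
    ; _≈_ = _≈_ on value
    ; _∙_ = λ (unit x x⁻¹ p) (unit y y⁻¹ r) → unit (x * y) (x⁻¹ * y⁻¹)
        (trans (interchange x y x⁻¹ y⁻¹) (trans (*-cong p r) (*-identityˡ 1#)))
    ; ε = unit 1# 1# (*-identityˡ 1#)
    ; _⁻¹ = λ (unit x x⁻¹ p) → unit x⁻¹ x (trans (*-comm x⁻¹ x) p)
    ; isGroup = record
      { isMonoid = record
        { isSemigroup = record
          { isMagma = record
            { isEquivalence = On.isEquivalence value isEquivalence
            ; ∙-cong = *-cong
            }
          ; assoc = λ x y z → *-assoc (value x) (value y) (value z)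
          }
        ; identity = *-identityˡ ∘ value , *-identityʳ ∘ value
        }
      ; inverse = (λ (unit x x⁻¹ p) → trans (*-comm x⁻¹ x) p) , inverse
      ; ⁻¹-cong = λ { {unit x x⁻¹ p} {unit y y⁻¹ r} x≈y →
          trans (sym (*-identityʳ x⁻¹))
          (trans (*-congˡ (sym r))
          (trans (sym (*-assoc x⁻¹ y y⁻¹))
          (trans (*-congʳ (trans (*-congˡ (sym x≈y)) (trans (*-comm x⁻¹ x) p)))
          (*-identityˡ y⁻¹)))) }
      }
    }

-- The quaternion group: (s , e) stands for the signed basis quaternion s e.

data Basis : Set where
  𝟙 𝕚 𝕛 𝕜 : Basis

infixl 7 _·Q_

_·Q_ : Basis → Basis → Sign × Basis
𝟙 ·Q e = Sign.+ , e
𝕚 ·Q 𝟙 = Sign.+ , 𝕚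
𝕚 ·Q 𝕚 = Sign.- , 𝟙
𝕚 ·Q 𝕛 = Sign.+ , 𝕜
𝕚 ·Q 𝕜 = Sign.- , 𝕛
𝕛 ·Q 𝟙 = Sign.+ , 𝕛
𝕛 ·Q 𝕚 = Sign.- , 𝕜
𝕛 ·Q 𝕛 = Sign.- , 𝟙
𝕛 ·Q 𝕜 = Sign.+ , 𝕚
𝕜 ·Q 𝟙 = Sign.+ , 𝕜
𝕜 ·Q 𝕚 = Sign.+ , 𝕛
𝕜 ·Q 𝕛 = Sign.- , 𝕚
𝕜 ·Q 𝕜 = Sign.- , 𝟙

module _ where

  private
    Q : Set
    Q = Sign × Basis

    _∙_ : Q → Q → Q
    (s , d) ∙ (t , e) = (s Sign.* t) Sign.* proj₁ (d ·Q e) , proj₂ (d ·Q e)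

    _⁻¹ : Q → Q
    (s , 𝟙) ⁻¹ = s , 𝟙
    (s , e) ⁻¹ = Sign.opposite s , e

    _≟B_ : DecidableEquality Basis
    𝟙 ≟B 𝟙 = yes ≡.refl
    𝟙 ≟B 𝕚 = no λ ()
    𝟙 ≟B 𝕛 = no λ ()
    𝟙 ≟B 𝕜 = no λ ()
    𝕚 ≟B 𝟙 = no λ ()
    𝕚 ≟B 𝕚 = yes ≡.refl
    𝕚 ≟B 𝕛 = no λ ()
    𝕚 ≟B 𝕜 = no λ ()
    𝕛 ≟B 𝟙 = no λ ()
    𝕛 ≟B 𝕚 = no λ ()
    𝕛 ≟B 𝕛 = yes ≡.refl
    𝕛 ≟B 𝕜 = no λ ()
    𝕜 ≟B 𝟙 = no λ ()
    𝕜 ≟B 𝕚 = no λ ()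
    𝕜 ≟B 𝕛 = no λ ()
    𝕜 ≟B 𝕜 = yes ≡.refl

    _≟_ : DecidableEquality Q
    _≟_ = ≡-dec Sign._≟_ _≟B_

    all? : {P : Pred Q 0ℓ} → Decidable P → Dec (∀ x → P x)
    all? {P} P? = map′ to from (signs? Sign.+ ×-dec signs? Sign.-)
      where
      Four : Sign → Set
      Four s = P (s , 𝟙) × P (s , 𝕚) × P (s , 𝕛) × P (s , 𝕜)
      signs? : Decidable Four
      signs? s = P? (s , 𝟙) ×-dec P? (s , 𝕚) ×-dec P? (s , 𝕛) ×-dec P? (s , 𝕜)
      pick : ∀ {s} → Four s → ∀ e → P (s , e)
      pick (p , _ , _ , _) 𝟙 = p
      pick (_ , p , _ , _) 𝕚 = p
      pick (_ , _ , p , _) 𝕛 = p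
      pick (_ , _ , _ , p) 𝕜 = p
      to : Four Sign.+ × Four Sign.- → ∀ x → P x
      to (p , _) (Sign.+ , e) = pick p e
      to (_ , p) (Sign.- , e) = pick p e
      from : (∀ x → P x) → Four Sign.+ × Four Sign.-
      from h = (h _ , h _ , h _ , h _) , (h _ , h _ , h _ , h _)

    assoc : ∀ x y z → (x ∙ y) ∙ z ≡ x ∙ (y ∙ z)
    assoc = from-yes (all? λ x → all? λ y → all? λ z → ((x ∙ y) ∙ z) ≟ (x ∙ (y ∙ z)))

    identityˡ : ∀ x → (Sign.+ , 𝟙) ∙ x ≡ x
    identityˡ = from-yes (all? λ x → ((Sign.+ , 𝟙) ∙ x) ≟ x)

    identityʳ : ∀ x → x ∙ (Sign.+ , 𝟙) ≡ x
    identityʳ = from-yes (all? λ x → (x ∙ (Sign.+ , 𝟙)) ≟ x)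

    inverseˡ : ∀ x → (x ⁻¹) ∙ x ≡ (Sign.+ , 𝟙)
    inverseˡ = from-yes (all? λ x → ((x ⁻¹) ∙ x) ≟ (Sign.+ , 𝟙))

    inverseʳ : ∀ x → x ∙ (x ⁻¹) ≡ (Sign.+ , 𝟙)
    inverseʳ = from-yes (all? λ x → (x ∙ (x ⁻¹)) ≟ (Sign.+ , 𝟙))

  Q₈ : Group 0ℓ 0ℓ
  Q₈ = record
    { Carrier = Q ; _≈_ = _≡_ ; _∙_ = _∙_ ; ε = Sign.+ , 𝟙 ; _⁻¹ = _⁻¹
    ; isGroup = record
      { isMonoid = record
        { isSemigroup = record
          { isMagma = record { isEquivalence = ≡.isEquivalence ; ∙-cong = ≡.cong₂ _∙_ }
          ; assoc = assoc
          }
        ; identity = identityˡ , identityʳ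
        }
      ; inverse = inverseˡ , inverseʳ
      ; ⁻¹-cong = ≡.cong _⁻¹
      }
    }

Sym : ℕ → Group 0ℓ 0ℓ
Sym n = record
  { Carrier = Permutation′ n
  ; _≈_ = Perm._≈_
  ; _∙_ = _∘ₚ_
  ; ε = Perm.id
  ; _⁻¹ = Perm.flip
  ; isGroup = record
    { isMonoid = record
      { isSemigroup = record
        { isMagma = record
          { isEquivalence = record
            { refl = λ _ → ≡.refl
            ; sym = λ p i → ≡.sym (p i)
            ; trans = λ p r i → ≡.trans (p i) (r i)
            }
          ; ∙-cong = λ {π} {π′} {ρ} p r i → ≡.trans (≡.cong (ρ ⟨$⟩ʳ_) (p i)) (r (π′ ⟨$⟩ʳ i))
          }
        ; assoc = λ _ _ _ _ → ≡.refl
        }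
      ; identity = (λ _ _ → ≡.refl) , (λ _ _ → ≡.refl)
      }
    ; inverse = (λ π _ → Perm.inverseʳ π) , (λ π _ → Perm.inverseˡ π)
    ; ⁻¹-cong = λ {π} {ρ} p i → ≡.trans
        (≡.cong (π ⟨$⟩ˡ_) (≡.trans (≡.sym (Perm.inverseʳ ρ)) (≡.sym (p (ρ ⟨$⟩ˡ i)))))
        (Perm.inverseˡ π)
    }
  }

-- Entries (i , i) of a TranspositionList evaluate to the identity, so they
-- have to be excluded for the parity of the length to be meaningful.
Even : Pred (Permutation′ n) 0ℓ
Even {n} π = ∃[ ts ] All (λ (i , j) → i ≢ j) ts × 2 ℕ.∣ length ts × eval {n} ts Perm.≈ π

private

  Proper : Pred (TranspositionList n) 0ℓ
  Proper = All (λ (i , j) → i ≢ j)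

  eval-++ : ∀ (ts us : TranspositionList n) i →
            eval (ts List.++ us) ⟨$⟩ʳ i ≡ eval us ⟨$⟩ʳ (eval ts ⟨$⟩ʳ i)
  eval-++ []             us i = ≡.refl
  eval-++ ((k , l) ∷ ts) us i = eval-++ ts us (transpose k l ⟨$⟩ʳ i)

  eval-inverse : ∀ (ts : TranspositionList n) → Proper ts →
                 ∃[ us ] Proper us × length us ≡ length ts ×
                   (∀ i → eval us ⟨$⟩ʳ (eval ts ⟨$⟩ʳ i) ≡ i)
  eval-inverse [] _ = [] , All.[] , ≡.refl , λ _ → ≡.refl
  eval-inverse ((k , l) ∷ ts) (k≢l All.∷ p) =
    let us , p′ , len , inv = eval-inverse ts p in
      us List.++ List.[ (l , k) ]
    , All.++⁺ p′ (k≢l ∘ ≡.sym All.∷ All.[])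
    , ≡.trans (List.length-++-comm us List.[ (l , k) ]) (≡.cong ℕ.suc len)
    , λ i → ≡.trans (eval-++ us List.[ (l , k) ] _)
              (≡.trans (≡.cong (transpose l k ⟨$⟩ʳ_) (inv (transpose k l ⟨$⟩ʳ i)))
                       (PC.transpose-inverse l k))

Alt : ∀ n → Subgroup (Sym n)
Alt n = record
  { Member = Even
  ; resp = λ π≈ρ (ts , p , e , eq) → ts , p , e , λ i → ≡.trans (eq i) (π≈ρ i)
  ; ε-closed = [] , All.[] , ℕ._∣0 2 , λ _ → ≡.refl
  ; ∙-closed = λ { {π} {ρ} (ts , p , e , eq) (us , p′ , e′ , eq′) →
        ts List.++ us
      , All.++⁺ p p′
      , ≡.subst (2 ℕ.∣_) (≡.sym (List.length-++ ts)) (ℕ.∣m∣n⇒∣m+n e e′)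
      , λ i → ≡.trans (eval-++ ts us i)
                (≡.trans (eq′ (eval ts ⟨$⟩ʳ i)) (≡.cong (ρ ⟨$⟩ʳ_) (eq i))) }
  ; ⁻¹-closed = λ { {π} (ts , p , e , eq) →
      let us , p′ , len , inv = eval-inverse ts p in
        us , p′ , ≡.subst (2 ℕ.∣_) (≡.sym len) e
      , λ i → ≡.trans
          (≡.cong (eval us ⟨$⟩ʳ_) (≡.sym (≡.trans (eq (π ⟨$⟩ˡ i)) (Perm.inverseʳ π))))
          (inv (π ⟨$⟩ˡ i)) }
  }

------------------------------------------------------------------------
-- Linear algebra; vectors are rows and matrices act on the right

module LinearAlgebra (R : CommutativeRing 0ℓ 0ℓ) where

  open CommutativeRing R
  open SemiringSum semiring using (sum; sum-cong-≋; ∑-distrib-+; *-distribˡ-sum; sum-replicate-zero)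
  open VectorEquality setoid public using (_≋_; ≋-refl; ≋-sym; ≋-trans)

  Matrix : ℕ → ℕ → Set
  Matrix m n = Vector (Vector Carrier n) m

  0ᵥ : Vector Carrier n
  0ᵥ _ = 0#

  infixl 6 _+ᵥ_
  infixl 7 _*ᵥ_ _·_ _⊡_

  _+ᵥ_ : Vector Carrier n → Vector Carrier n → Vector Carrier n
  (u +ᵥ v) i = u i + v i

  _*ᵥ_ : Carrier → Vector Carrier n → Vector Carrier n
  (c *ᵥ v) i = c * v i

  _·_ : Vector Carrier m → Matrix m n → Vector Carrier n
  (u · A) j = sum (λ i → u i * A i j)

  _⊡_ : Matrix k m → Matrix m n → Matrix k n
  (A ⊡ B) i = A i · B

  I : Matrix n n
  I zero    zero    = 1#
  I zero    (suc _) = 0#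
  I (suc _) zero    = 0#
  I (suc i) (suc j) = I i j

  [_∣_] : Matrix k m → Matrix k n → Matrix k (m ℕ.+ n)
  [ A ∣ B ] i = A i ++ B i

  record Subspace (n : ℕ) : Set₁ where
    field
      Member    : Pred (Vector Carrier n) 0ℓ
      resp      : Member Respects _≋_
      0-closed  : 0ᵥ ∈ Member
      +-closed  : ∀ {u v} → u ∈ Member → v ∈ Member → u +ᵥ v ∈ Member
      *-closed  : ∀ c {v} → v ∈ Member → c *ᵥ v ∈ Member

  open Subspace public using (Member)

  infix 4 _≤ₛ_ _≈ₛ_

  _≤ₛ_ _≈ₛ_ : Rel (Subspace n) 0ℓ
  U ≤ₛ W = Member U ⊆ Member W
  U ≈ₛ W = Member U ≐ Member W

  rowSpace : Matrix k n → Subspace n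
  rowSpace {k = k} B = record
    { Member = λ v → ∃[ c ] v ≋ c · B
    ; resp = λ u≋v (c , eq) → c , λ j → trans (sym (u≋v j)) (eq j)
    ; 0-closed = 0ᵥ , λ j → sym (trans (sum-cong-≋ (λ i → zeroˡ (B i j))) (sum-replicate-zero k))
    ; +-closed = λ (c , eq) (d , eq′) → c +ᵥ d , λ j → trans (+-cong (eq j) (eq′ j))
        (trans (sym (∑-distrib-+ (λ i → c i * B i j) (λ i → d i * B i j)))
               (sum-cong-≋ (λ i → sym (distribʳ (B i j) (c i) (d i)))))
    ; *-closed = λ a (c , eq) → a *ᵥ c , λ j → trans (*-congˡ (eq j))
        (trans (*-distribˡ-sum a (λ i → c i * B i j))
               (sum-cong-≋ (λ i → sym (*-assoc a (c i) (B i j)))))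
    }

  RowsIndependent : Matrix k n → Set
  RowsIndependent B = ∀ c → c · B ≋ 0ᵥ → c ≋ 0ᵥ

  HasDimension : ℕ → Subspace n → Set
  HasDimension {n} k U = Σ[ B ∈ Matrix k n ] RowsIndependent B × U ≈ₛ rowSpace B

------------------------------------------------------------------------
-- SL₂(q)

module _ (q : ℕ) where

  open CommutativeRing (𝔽 q)
  open LinearAlgebra (𝔽 q)

  det : Matrix 2 2 → Carrier
  det A = A 0F 0F * A 1F 1F - A 0F 1F * A 1F 0F

  record SL₂Matrix : Set where
    constructor sl₂
    field
      matrix : Matrix 2 2
      det≈1  : det matrix ≈ 1#

  open SL₂Matrix

  private
    infix 4 _≈ₘ_
    _≈ₘ_ : Rel (Matrix 2 2) 0ℓ
    A ≈ₘ B = ∀ i j → A i j ≈ B i j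

    adjugate : Matrix 2 2 → Matrix 2 2
    adjugate A 0F 0F = A 1F 1F
    adjugate A 0F 1F = - A 0F 1F
    adjugate A 1F 0F = - A 1F 0F
    adjugate A 1F 1F = A 0F 0F

    det-⊡ : ∀ a b c d e f g h →
      (a ℤ.* e ℤ.+ (b ℤ.* g ℤ.+ + 0)) ℤ.* (c ℤ.* f ℤ.+ (d ℤ.* h ℤ.+ + 0))
        ℤ.- (a ℤ.* f ℤ.+ (b ℤ.* h ℤ.+ + 0)) ℤ.* (c ℤ.* e ℤ.+ (d ℤ.* g ℤ.+ + 0)) ≡
      (a ℤ.* d ℤ.- b ℤ.* c) ℤ.* (e ℤ.* h ℤ.- f ℤ.* g)
    det-⊡ = solve-∀

    det-adjugate : ∀ a b c d → d ℤ.* a ℤ.- (ℤ.- b) ℤ.* (ℤ.- c) ≡ a ℤ.* d ℤ.- b ℤ.* c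
    det-adjugate = solve-∀

    assoc : ∀ a b e f g h x y →
      (a ℤ.* e ℤ.+ (b ℤ.* g ℤ.+ + 0)) ℤ.* x ℤ.+ ((a ℤ.* f ℤ.+ (b ℤ.* h ℤ.+ + 0)) ℤ.* y ℤ.+ + 0) ≡
      a ℤ.* (e ℤ.* x ℤ.+ (f ℤ.* y ℤ.+ + 0)) ℤ.+ (b ℤ.* (g ℤ.* x ℤ.+ (h ℤ.* y ℤ.+ + 0)) ℤ.+ + 0)
    assoc = solve-∀

    select₀ˡ : ∀ a b → + 1 ℤ.* a ℤ.+ (+ 0 ℤ.* b ℤ.+ + 0) ≡ a
    select₀ˡ = solve-∀
    select₁ˡ : ∀ a b → + 0 ℤ.* a ℤ.+ (+ 1 ℤ.* b ℤ.+ + 0) ≡ b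
    select₁ˡ = solve-∀
    select₀ʳ : ∀ a b → a ℤ.* + 1 ℤ.+ (b ℤ.* + 0 ℤ.+ + 0) ≡ a
    select₀ʳ = solve-∀
    select₁ʳ : ∀ a b → a ℤ.* + 0 ℤ.+ (b ℤ.* + 1 ℤ.+ + 0) ≡ b
    select₁ʳ = solve-∀

    identityˡ : ∀ A → I ⊡ A ≈ₘ A
    identityˡ A 0F j = reflexive (select₀ˡ (A 0F j) (A 1F j))
    identityˡ A 1F j = reflexive (select₁ˡ (A 0F j) (A 1F j))

    identityʳ : ∀ A → A ⊡ I ≈ₘ A
    identityʳ A i 0F = reflexive (select₀ʳ (A i 0F) (A i 1F))
    identityʳ A i 1F = reflexive (select₁ʳ (A i 0F) (A i 1F))

    adj₀₀ : ∀ a b c d → d ℤ.* a ℤ.+ ((ℤ.- b) ℤ.* c ℤ.+ + 0) ≡ a ℤ.* d ℤ.- b ℤ.* c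
    adj₀₀ = solve-∀
    adj₀₁ : ∀ b d → d ℤ.* b ℤ.+ ((ℤ.- b) ℤ.* d ℤ.+ + 0) ≡ + 0
    adj₀₁ = solve-∀
    adj₁₀ : ∀ a c → (ℤ.- c) ℤ.* a ℤ.+ (a ℤ.* c ℤ.+ + 0) ≡ + 0
    adj₁₀ = solve-∀
    adj₁₁ : ∀ a b c d → (ℤ.- c) ℤ.* b ℤ.+ (a ℤ.* d ℤ.+ + 0) ≡ a ℤ.* d ℤ.- b ℤ.* c
    adj₁₁ = solve-∀

    adj₀₀′ : ∀ a b c d → a ℤ.* d ℤ.+ (b ℤ.* (ℤ.- c) ℤ.+ + 0) ≡ a ℤ.* d ℤ.- b ℤ.* c
    adj₀₀′ = solve-∀
    adj₀₁′ : ∀ a b → a ℤ.* (ℤ.- b) ℤ.+ (b ℤ.* a ℤ.+ + 0) ≡ + 0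
    adj₀₁′ = solve-∀
    adj₁₀′ : ∀ c d → c ℤ.* d ℤ.+ (d ℤ.* (ℤ.- c) ℤ.+ + 0) ≡ + 0
    adj₁₀′ = solve-∀
    adj₁₁′ : ∀ a b c d → c ℤ.* (ℤ.- b) ℤ.+ (d ℤ.* a ℤ.+ + 0) ≡ a ℤ.* d ℤ.- b ℤ.* c
    adj₁₁′ = solve-∀

    inverseˡ : ∀ A → det A ≈ 1# → adjugate A ⊡ A ≈ₘ I
    inverseˡ A p 0F 0F = trans (reflexive (adj₀₀ (A 0F 0F) (A 0F 1F) (A 1F 0F) (A 1F 1F))) p
    inverseˡ A p 0F 1F = reflexive (adj₀₁ (A 0F 1F) (A 1F 1F))
    inverseˡ A p 1F 0F = reflexive (adj₁₀ (A 0F 0F) (A 1F 0F))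
    inverseˡ A p 1F 1F = trans (reflexive (adj₁₁ (A 0F 0F) (A 0F 1F) (A 1F 0F) (A 1F 1F))) p

    inverseʳ : ∀ A → det A ≈ 1# → A ⊡ adjugate A ≈ₘ I
    inverseʳ A p 0F 0F = trans (reflexive (adj₀₀′ (A 0F 0F) (A 0F 1F) (A 1F 0F) (A 1F 1F))) p
    inverseʳ A p 0F 1F = reflexive (adj₀₁′ (A 0F 0F) (A 0F 1F))
    inverseʳ A p 1F 0F = reflexive (adj₁₀′ (A 1F 0F) (A 1F 1F))
    inverseʳ A p 1F 1F = trans (reflexive (adj₁₁′ (A 0F 0F) (A 0F 1F) (A 1F 0F) (A 1F 1F))) p

    adjugate-cong : ∀ {A B} → A ≈ₘ B → adjugate A ≈ₘ adjugate B
    adjugate-cong p 0F 0F = p 1F 1F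
    adjugate-cong p 0F 1F = -‿cong (p 0F 1F)
    adjugate-cong p 1F 0F = -‿cong (p 1F 0F)
    adjugate-cong p 1F 1F = p 0F 0F

  SL₂ : Group 0ℓ 0ℓ
  SL₂ = record
    { Carrier = SL₂Matrix
    ; _≈_ = _≈ₘ_ on matrix
    ; _∙_ = λ (sl₂ A p) (sl₂ B r) → sl₂ (A ⊡ B)
        (trans (reflexive (det-⊡ (A 0F 0F) (A 0F 1F) (A 1F 0F) (A 1F 1F)
                                 (B 0F 0F) (B 0F 1F) (B 1F 0F) (B 1F 1F)))
               (trans (*-cong p r) (*-identityˡ 1#)))
    ; ε = sl₂ I refl
    ; _⁻¹ = λ (sl₂ A p) → sl₂ (adjugate A)
        (trans (reflexive (det-adjugate (A 0F 0F) (A 0F 1F) (A 1F 0F) (A 1F 1F))) p)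
    ; isGroup = record
      { isMonoid = record
        { isSemigroup = record
          { isMagma = record
            { isEquivalence = record
              { refl = λ _ _ → refl
              ; sym = λ p i j → sym (p i j)
              ; trans = λ p r i j → trans (p i j) (r i j)
              }
            ; ∙-cong = λ p r i j →
                +-cong (*-cong (p i 0F) (r 0F j)) (+-cong (*-cong (p i 1F) (r 1F j)) refl)
            }
          ; assoc = λ (sl₂ A _) (sl₂ B _) (sl₂ C _) i j →
              reflexive (assoc (A i 0F) (A i 1F) (B 0F 0F) (B 0F 1F) (B 1F 0F) (B 1F 1F)
                               (C 0F j) (C 1F j))
          }
        ; identity = identityˡ ∘ matrix , identityʳ ∘ matrix
        }
      ; inverse = (λ (sl₂ A p) → inverseˡ A p) , (λ (sl₂ A p) → inverseʳ A p)
      ; ⁻¹-cong = adjugate-cong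
      }
    }

  SharplyTransitive : Subgroup SL₂ → Set
  SharplyTransitive G = ∀ (u v : Vector Carrier 2) → ¬ u ≋ 0ᵥ → ¬ v ≋ 0ᵥ →
    ∃! (Group._≈_ SL₂) λ A → A ∈ Subgroup.Member G × u · matrix A ≋ v

------------------------------------------------------------------------
-- Codes in a graph with vertex setoid V and adjacency relation _~_

module Codes {c ℓ e : Level} (V : Setoid c ℓ) (_~_ : Rel (Setoid.Carrier V) e) where

  open Setoid V

  record Automorphism : Set (c ⊔ ℓ ⊔ e) where
    field
      inverse   : Inverse V V
      adjacency : ∀ x y → (x ~ y) ⇔ (Inverse.to inverse x ~ Inverse.to inverse y)
    open Inverse inverse public using (to)

  open Automorphism

  module _ {s : Level} (C : Pred Carrier s) where

    Neighbours : Pred Carrier (c ⊔ e ⊔ s)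
    Neighbours v = ¬ v ∈ C × (∃[ u ] u ∈ C × u ~ v)

    Stabilises : Pred Automorphism (c ⊔ s)
    Stabilises g = ∀ x → (x ∈ C) ⇔ (to g x ∈ C)

    StabiliserTransitiveOn : ∀ {t} → Pred Carrier t → Set (c ⊔ ℓ ⊔ e ⊔ s ⊔ t)
    StabiliserTransitiveOn S = ∀ x y → x ∈ S → y ∈ S → ∃[ g ] Stabilises g × to g x ≈ y

    NeighbourTransitive : Set (c ⊔ ℓ ⊔ e ⊔ s)
    NeighbourTransitive = StabiliserTransitiveOn C × StabiliserTransitiveOn Neighbours

------------------------------------------------------------------------
-- The generalised quadrangle W₃(q)

module W₃ (q : ℕ) where

  open CommutativeRing (𝔽 q)
  open LinearAlgebra (𝔽 q)

  V : Set
  V = Vector Carrier 4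

  form : V → V → Carrier
  form x y = x 0F * y 1F - x 1F * y 0F - x 2F * y 3F + x 3F * y 2F

  TotallyIsotropic : Subspace 4 → Set
  TotallyIsotropic U = ∀ {x y} → x ∈ Member U → y ∈ Member U → form x y ≈ 0#

  IsPoint IsLine : Subspace 4 → Set
  IsPoint U = HasDimension 1 U
  IsLine  U = HasDimension 2 U × TotallyIsotropic U

  record Vertex : Set₁ where
    field
      subspace : Subspace 4
      isVertex : IsPoint subspace ⊎ IsLine subspace

  open Vertex public using (subspace)

  vertexSetoid : Setoid (lsuc 0ℓ) 0ℓ
  vertexSetoid = record
    { Carrier = Vertex
    ; _≈_ = _≈ₛ_ on subspace
    ; isEquivalence = record { refl = ≐-refl ; sym = ≐-sym ; trans = ≐-trans }
    }

  -- Adjacency is incidence, i.e. symmetrised containment between points and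
  -- lines.
  PointOnLine : Rel (Subspace 4) 0ℓ
  PointOnLine P L = IsPoint P × IsLine L × P ≤ₛ L

  Adjacent : Rel Vertex 0ℓ
  Adjacent x y = PointOnLine (subspace x) (subspace y) ⊎ PointOnLine (subspace y) (subspace x)

  open Codes vertexSetoid Adjacent public

  -- Sets of lines are given as sets of subspaces, so that being a partial
  -- spread includes the claim that every member is a line of W₃(q).
  record IsPartialSpread (S : Pred (Subspace 4) 0ℓ) : Set₁ where
    field
      resp     : S Respects _≈ₛ_
      lines    : ∀ {L} → L ∈ S → IsLine L
      disjoint : ∀ {P L M} → L ∈ S → M ∈ S → PointOnLine P L → PointOnLine P M → L ≈ₛ M

  -- T ⊆ S is the positive form of "T does not properly contain S".
  IsMaximalPartialSpread : Pred (Subspace 4) 0ℓ → Set₁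
  IsMaximalPartialSpread S =
    IsPartialSpread S × (∀ T → IsPartialSpread T → S ⊆ T → T ⊆ S)

  -- A set of lines regarded as a code, i.e. as a set of vertices.
  code : Pred (Subspace 4) 0ℓ → Pred Vertex 0ℓ
  code S x = subspace x ∈ S

  rowSpaces : Subgroup (SL₂ q) → Pred (Subspace 4) 0ℓ
  rowSpaces G L = ∃[ A ] A ∈ Subgroup.Member G × L ≈ₛ rowSpace [ I ∣ SL₂Matrix.matrix A ]

{-# OPTIONS --safe #-}

-- Write a vector of V as (u , w) with u , w ∈ 𝔽_q², so that
-- f((u , w) , (u′ , w′)) = det(u , u′) - det(w , w′) and the members of C are the
-- graphs w = u A with A ∈ G.  By sharp transitivity each point ⟨(u , w)⟩ with
-- u ≠ 0 ≠ w lies on exactly one of them, and no other point is covered.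
-- C is maximal since every totally isotropic line contains a vector with
-- u ≠ 0 ≠ w: the planes w = 0 and u = 0 are non-degenerate.  C is
-- neighbour-transitive since the isometries (u , w) ↦ (u A , w B) with A , B ∈ G
-- permute the graphs, transitively, and act transitively on the vectors with
-- u ≠ 0 ≠ w.

module Submission where

open import Algebra.Bundles using (CommutativeRing; Group)
import Algebra.Properties.Group as GroupProperties
import Algebra.Properties.Semiring.Sum as SemiringSum
open import Data.Fin.Base using (Fin; zero; suc; _↑ˡ_; _↑ʳ_)
open import Data.Fin.Patterns using (0F; 1F; 2F; 3F)
open import Data.Fin.Properties using (all?)
open import Data.Integer.Base as ℤ using (+_)
import Data.Integer.Divisibility.Signed as ℤ
open import Data.Integer.Tactic.RingSolver using (solve-∀)
import Data.List.Relation.Unary.All as All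
open import Data.Nat.Base as ℕ using (ℕ)
import Data.Nat.Divisibility as ℕ
open import Data.Product.Base using (_×_; _,_; ∃-syntax; proj₁; proj₂)
open import Data.Sum.Base as Sum using (inj₁; inj₂)
open import Data.Vec.Functional as Vec using (Vector; _++_; take; drop; tail)
open import Function.Base using (_∘_)
open import Function.Bundles using (_⇔_; mk⇔; Equivalence)
open import Level using (0ℓ)
open import Relation.Binary.PropositionalEquality using (_≡_; _≢_)
import Relation.Binary.Reasoning.Setoid as SetoidReasoning
open import Relation.Nullary.Decidable using (Dec; yes; no; map′)
open import Relation.Nullary.Negation using (¬_; contradiction)
import Relation.Unary as Unary
open import Relation.Unary.Properties using (≐-refl; ≐-sym; ≐-trans)
open import Defs

private
  variable
    k m n : ℕ

-- Row vectors, matrices and row spaces over a commutative ring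

module MatrixAction (R : CommutativeRing 0ℓ 0ℓ) where

  open CommutativeRing R hiding (zero)
  open LinearAlgebra R
  open SemiringSum semiring
    using (sum; sum-cong-≋; ∑-distrib-+; ∑-comm; *-distribˡ-sum; *-distribʳ-sum; sum-replicate-zero)
  open SetoidReasoning setoid

  ·-cong : ∀ {u v : Vector Carrier m} {A B : Matrix m n} →
           u ≋ v → (∀ i → A i ≋ B i) → u · A ≋ v · B
  ·-cong u≋v A≋B j = sum-cong-≋ λ i → *-cong (u≋v i) (A≋B i j)

  ·-congˡ : ∀ {u v : Vector Carrier m} (A : Matrix m n) → u ≋ v → u · A ≋ v · A
  ·-congˡ A u≋v = ·-cong u≋v (λ _ _ → refl)

  ·-congʳ : ∀ (u : Vector Carrier m) {A B : Matrix m n} → (∀ i → A i ≋ B i) → u · A ≋ u · B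
  ·-congʳ u A≋B = ·-cong (λ _ → refl) A≋B

  0ᵥ-· : ∀ (A : Matrix m n) → 0ᵥ · A ≋ 0ᵥ
  0ᵥ-· {m} A j = trans (sum-cong-≋ λ i → zeroˡ (A i j)) (sum-replicate-zero m)

  +ᵥ-· : ∀ (u v : Vector Carrier m) (A : Matrix m n) → (u +ᵥ v) · A ≋ u · A +ᵥ v · A
  +ᵥ-· u v A j = trans (sum-cong-≋ λ i → distribʳ (A i j) (u i) (v i))
                       (∑-distrib-+ (λ i → u i * A i j) (λ i → v i * A i j))

  *ᵥ-· : ∀ c (v : Vector Carrier m) (A : Matrix m n) → (c *ᵥ v) · A ≋ c *ᵥ (v · A)
  *ᵥ-· c v A j = trans (sum-cong-≋ λ i → *-assoc c (v i) (A i j))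
                       (sym (*-distribˡ-sum c λ i → v i * A i j))

  ·-assoc : ∀ (u : Vector Carrier k) (A : Matrix k m) (B : Matrix m n) →
            (u · A) · B ≋ u · (A ⊡ B)
  ·-assoc u A B l = begin
    sum (λ j → sum (λ i → u i * A i j) * B j l)
      ≈⟨ sum-cong-≋ (λ j → *-distribʳ-sum (B j l) λ i → u i * A i j) ⟩
    sum (λ j → sum λ i → u i * A i j * B j l)
      ≈⟨ ∑-comm (λ j i → u i * A i j * B j l) ⟩
    sum (λ i → sum λ j → u i * A i j * B j l)
      ≈⟨ sum-cong-≋ (λ i → sum-cong-≋ λ j → *-assoc (u i) (A i j) (B j l)) ⟩
    sum (λ i → sum λ j → u i * (A i j * B j l))
      ≈⟨ sum-cong-≋ (λ i → *-distribˡ-sum (u i) λ j → A i j * B j l) ⟨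
    sum (λ i → u i * sum λ j → A i j * B j l) ∎

  ·-identityʳ : ∀ (u : Vector Carrier n) → u · I ≋ u
  ·-identityʳ {ℕ.suc n} u zero = begin
    u zero * 1# + sum (λ i → u (suc i) * 0#)
      ≈⟨ +-cong (*-identityʳ (u zero)) (sum-cong-≋ λ i → zeroʳ (u (suc i))) ⟩
    u zero + sum {n} (λ _ → 0#)
      ≈⟨ +-congˡ (sum-replicate-zero n) ⟩
    u zero + 0#
      ≈⟨ +-identityʳ (u zero) ⟩
    u zero ∎
  ·-identityʳ {ℕ.suc n} u (suc j) =
    trans (+-cong (zeroʳ (u zero)) (·-identityʳ (tail u) j)) (+-identityˡ (u (suc j)))

  *ᵥ-zeroʳ : ∀ c {v : Vector Carrier n} → v ≋ 0ᵥ → c *ᵥ v ≋ 0ᵥ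
  *ᵥ-zeroʳ c v≋0 j = trans (*-congˡ (v≋0 j)) (zeroʳ c)

  ·-zeroʳ : ∀ (c : Vector Carrier m) (A : Matrix m n) → (∀ i → A i ≋ 0ᵥ) → c · A ≋ 0ᵥ
  ·-zeroʳ {m} c A A≋0 j =
    trans (sum-cong-≋ λ i → *ᵥ-zeroʳ (c i) (A≋0 i) j) (sum-replicate-zero m)

  single-row-· : ∀ (c : Vector Carrier 1) (B : Matrix 1 n) → c · B ≋ c 0F *ᵥ B 0F
  single-row-· c B j = +-identityʳ (c 0F * B 0F j)

  I-·ˡ : ∀ (A : Matrix m n) i → I i · A ≋ A i
  I-·ˡ {ℕ.suc m} A zero j = trans
    (+-cong (*-identityˡ (A zero j)) (0ᵥ-· (A ∘ suc) j))
    (+-identityʳ (A zero j))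
  I-·ˡ A (suc i) j = trans
    (+-cong (zeroˡ (A zero j)) (I-·ˡ (A ∘ suc) i j))
    (+-identityˡ (A (suc i) j))

  I-diagonal : ∀ (i : Fin n) → I i i ≈ 1#
  I-diagonal zero    = refl
  I-diagonal (suc i) = I-diagonal i

  -- The i-th unit vector is a coefficient vector producing row `i`, and its diagonal entry is 1; a
  -- zero row would therefore contradict independence.
  independent⇒row≉0 : ¬ 1# ≈ 0# → ∀ (B : Matrix m n) → RowsIndependent B → ∀ i → ¬ B i ≋ 0ᵥ
  independent⇒row≉0 1≉0 B independent i Bi≋0 =
    1≉0 (trans (sym (I-diagonal i)) (independent (I i) (≋-trans (I-·ˡ B i) Bi≋0) i))

  record IsLinear (f : Vector Carrier m → Vector Carrier n) : Set where
    field
      cong   : ∀ {u v} → u ≋ v → f u ≋ f v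
      +-homo : ∀ u v → f (u +ᵥ v) ≋ f u +ᵥ f v
      *-homo : ∀ c v → f (c *ᵥ v) ≋ c *ᵥ f v

    0-homo : f 0ᵥ ≋ 0ᵥ
    0-homo j = begin
      -- The zero vector is rewritten as a scalar multiple of itself so that homogeneity applies.
      f 0ᵥ j         ≈⟨ cong (λ _ → sym (zeroˡ 0#)) j ⟩
      f (0# *ᵥ 0ᵥ) j ≈⟨ *-homo 0# 0ᵥ j ⟩
      0# * f 0ᵥ j    ≈⟨ zeroˡ (f 0ᵥ j) ⟩
      0#             ∎

    -- Induction on the number of rows: a combination of `suc k` rows unfolds to its first term plus
    -- the combination of the remaining ones.
    ·-homo : ∀ (c : Vector Carrier k) B → f (c · B) ≋ c · (f ∘ B)
    ·-homo {ℕ.zero}  c B   = 0-homo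
    ·-homo {ℕ.suc k} c B j = begin
      f (c zero *ᵥ B zero +ᵥ tail c · tail B) j
        ≈⟨ +-homo (c zero *ᵥ B zero) (tail c · tail B) j ⟩
      f (c zero *ᵥ B zero) j + f (tail c · tail B) j
        ≈⟨ +-cong (*-homo (c zero) (B zero) j) (·-homo (tail c) (tail B) j) ⟩
      (c · (f ∘ B)) j ∎

  ∈-rowSpace : ∀ (B : Matrix k n) i → Member (rowSpace B) (B i)
  ∈-rowSpace B i = I i , λ j → sym (I-·ˡ B i j)

  rowSpace-cong : ∀ (B B′ : Matrix k n) → (∀ i → B i ≋ B′ i) → rowSpace B ≈ₛ rowSpace B′
  rowSpace-cong B B′ B≋B′ =
    (λ (c , eq) → c , λ j → trans (eq j) (·-cong (λ _ → refl) B≋B′ j)) ,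
    (λ (c , eq) → c , λ j → trans (eq j) (·-cong (λ _ → refl) (λ i j → sym (B≋B′ i j)) j))

  HasDimension-resp : ∀ {U W : Subspace n} → U ≈ₛ W → HasDimension k U → HasDimension k W
  HasDimension-resp U≈W (B , independent , U≈B) =
    B , independent , ≐-trans (≐-sym U≈W) U≈B

-- Isometries of the symplectic space and their action on graphs

module Geometry (q : ℕ) where

  open CommutativeRing (𝔽 q) hiding (zero)
  open LinearAlgebra (𝔽 q)
  open MatrixAction (𝔽 q)
  open W₃ q
  open Unary using (_∈_)
  open Vec using ([]; _∷_)
  open SL₂Matrix
  open SetoidReasoning setoid
  module SL = Group (SL₂ q)

  left right : V → Vector Carrier 2
  left  = take 2
  right = drop 2

  entries : ∀ {u v : Vector Carrier 2} → u ≋ v → u 0F ≈ v 0F × u 1F ≈ v 1F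
  entries u≋v = u≋v 0F , u≋v 1F

  -- Hypotheses at the concrete indices, where _++_ computes.
  ≋-halves : ∀ (x y : V) → x 0F ≈ y 0F × x 1F ≈ y 1F → x 2F ≈ y 2F × x 3F ≈ y 3F → x ≋ y
  ≋-halves x y (p , _) _ 0F = p
  ≋-halves x y (_ , p) _ 1F = p
  ≋-halves x y _ (p , _) 2F = p
  ≋-halves x y _ (_ , p) 3F = p

  -- Isometries and the automorphisms they induce

  record IsIsometry (f : V → V) : Set where
    field
      isLinear  : IsLinear f
      form-homo : ∀ x y → form (f x) (f y) ≈ form x y

    open IsLinear isLinear public

  record Isometry : Set where
    field
      to from         : V → V
      to-isIsometry   : IsIsometry to
      from-isIsometry : IsIsometry from
      to-from         : ∀ v → to (from v) ≋ v
      from-to         : ∀ v → from (to v) ≋ v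

    module To   = IsIsometry to-isIsometry
    module From = IsIsometry from-isIsometry

    -- Encoded as the preimage under `from`, so that membership needs no witness and closure follows
    -- from linearity of `from`.
    image : Subspace 4 → Subspace 4
    image U = record
      { Member   = Member U ∘ from
      ; resp     = U.resp ∘ From.cong
      ; 0-closed = U.resp (≋-sym From.0-homo) U.0-closed
      ; +-closed = λ {u} {v} u∈ v∈ → U.resp (≋-sym (From.+-homo u v)) (U.+-closed u∈ v∈)
      ; *-closed = λ c {v} v∈ → U.resp (≋-sym (From.*-homo c v)) (U.*-closed c v∈)
      }
      where module U = Subspace U

    image-cong : ∀ {U W} → U ≈ₛ W → image U ≈ₛ image W
    image-cong (U≤W , W≤U) = (λ v∈ → U≤W v∈) , (λ v∈ → W≤U v∈)

    image-rowSpace : ∀ (B : Matrix k 4) → image (rowSpace B) ≈ₛ rowSpace (to ∘ B)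
    image-rowSpace B =
      (λ {v} (c , eq) → c ,
        ≋-trans (≋-sym (to-from v)) (≋-trans (To.cong eq) (To.·-homo c B))) ,
      (λ {v} (c , eq) → c ,
        ≋-trans (From.cong (≋-trans eq (≋-sym (To.·-homo c B)))) (from-to (c · B)))

    image-hasDimension : ∀ {U} → HasDimension k U → HasDimension k (image U)
    image-hasDimension {U = U} (B , independent , U≈B) =
      to ∘ B ,
      -- A vanishing combination of the image rows is pulled back by `from` to one of the rows of
      -- `B`.
      (λ c eq → independent c
        (≋-trans (≋-sym (from-to (c · B)))
        (≋-trans (From.cong (≋-trans (To.·-homo c B) eq))
        From.0-homo))) ,
      ≐-trans (image-cong {U} {rowSpace B} U≈B) (image-rowSpace B)

    image-isLine : ∀ {U} → IsLine U → IsLine (image U)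
    image-isLine {U} (dim , isotropic) =
      image-hasDimension {U = U} dim ,
      λ {x} {y} x∈ y∈ → trans (sym (From.form-homo x y)) (isotropic x∈ y∈)

    image-pointOnLine : ∀ {P L} → PointOnLine P L → PointOnLine (image P) (image L)
    image-pointOnLine {P} {L} (p , l , P≤L) =
      image-hasDimension {U = P} p , image-isLine {L} l , λ v∈ → P≤L v∈

    imageVertex : Vertex → Vertex
    imageVertex x = record
      { subspace = image (subspace x)
      ; isVertex = Sum.map (image-hasDimension {U = subspace x}) (image-isLine {subspace x})
                     (Vertex.isVertex x)
      }

  flip : Isometry → Isometry
  flip φ = record
    { to = from ; from = to
    ; to-isIsometry = from-isIsometry ; from-isIsometry = to-isIsometry
    ; to-from = from-to ; from-to = to-from
    }
    where open Isometry φ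

  image-flip : ∀ φ U → Isometry.image (flip φ) (Isometry.image φ U) ≈ₛ U
  image-flip φ U = Subspace.resp U (from-to _) , Subspace.resp U (≋-sym (from-to _))
    where open Isometry φ

  IsLine-resp : ∀ {U W} → U ≈ₛ W → IsLine U → IsLine W
  IsLine-resp {U} {W} U≈W (dim , isotropic) =
    HasDimension-resp {U = U} {W} U≈W dim ,
    λ x∈ y∈ → isotropic (proj₂ U≈W x∈) (proj₂ U≈W y∈)

  PointOnLine-resp : ∀ {P P′ L L′} → P ≈ₛ P′ → L ≈ₛ L′ → PointOnLine P L → PointOnLine P′ L′
  PointOnLine-resp {P} {P′} {L} {L′} P≈ L≈ (p , l , P≤L) =
    HasDimension-resp {U = P} {P′} P≈ p , IsLine-resp {L} {L′} L≈ l ,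
    λ v∈ → proj₁ L≈ (P≤L (proj₂ P≈ v∈))

  -- Incidence is reflected because the inverse isometry preserves it too and the two images cancel.
  automorphism : Isometry → Automorphism
  automorphism φ = record
    { inverse = record
      { to        = imageVertex
      ; from      = Ψ.imageVertex
      ; to-cong   = λ {x} {y} → image-cong {subspace x} {subspace y}
      ; from-cong = λ {x} {y} → Ψ.image-cong {subspace x} {subspace y}
      ; inverse   =
          (λ {x} {y} eq → ≐-trans
            (image-cong {subspace y} {Ψ.image (subspace x)} eq) (image-flip (flip φ) (subspace x))) ,
          (λ {x} {y} eq → ≐-trans
            (Ψ.image-cong {subspace y} {image (subspace x)} eq) (image-flip φ (subspace x)))
      }
    ; adjacency = λ x y → mk⇔
        (Sum.map (image-pointOnLine {subspace x} {subspace y})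
                 (image-pointOnLine {subspace y} {subspace x}))
        (Sum.map (reflect (subspace x) (subspace y)) (reflect (subspace y) (subspace x)))
    }
    where
    open Isometry φ
    module Ψ = Isometry (flip φ)
    reflect : ∀ P L → PointOnLine (image P) (image L) → PointOnLine P L
    reflect P L h = PointOnLine-resp {Ψ.image (image P)} {P} {Ψ.image (image L)} {L}
      (image-flip φ P) (image-flip φ L) (Ψ.image-pointOnLine {image P} {image L} h)

  -- Determinants and the form

  det-cong : ∀ (A B : Matrix 2 2) → (∀ i → A i ≋ B i) → det q A ≈ det q B
  det-cong A B A≋B = +-cong (*-cong (A≋B 0F 0F) (A≋B 1F 1F))
                            (-‿cong (*-cong (A≋B 0F 1F) (A≋B 1F 0F)))

  det-⊡ : ∀ A B → det q (A ⊡ B) ≈ det q A * det q B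
  det-⊡ A B = reflexive (expand
    (A 0F 0F) (A 0F 1F) (A 1F 0F) (A 1F 1F) (B 0F 0F) (B 0F 1F) (B 1F 0F) (B 1F 1F))
    where
    expand : ∀ a b c d e f g h →
      (a ℤ.* e ℤ.+ (b ℤ.* g ℤ.+ + 0)) ℤ.* (c ℤ.* f ℤ.+ (d ℤ.* h ℤ.+ + 0))
        ℤ.- (a ℤ.* f ℤ.+ (b ℤ.* h ℤ.+ + 0)) ℤ.* (c ℤ.* e ℤ.+ (d ℤ.* g ℤ.+ + 0)) ≡
      (a ℤ.* d ℤ.- b ℤ.* c) ℤ.* (e ℤ.* h ℤ.- f ℤ.* g)
    expand = solve-∀

  -- This turns statements about the form into statements about 2 × 2 determinants, where
  -- multiplicativity and determinant one can be used.
  form-det : ∀ (M : Matrix 2 4) → form (M 0F) (M 1F) ≈ det q (left ∘ M) - det q (right ∘ M)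
  form-det M = reflexive (expand
    (M 0F 0F) (M 0F 1F) (M 0F 2F) (M 0F 3F) (M 1F 0F) (M 1F 1F) (M 1F 2F) (M 1F 3F))
    where
    expand : ∀ a b c d e f g h →
      a ℤ.* f ℤ.- b ℤ.* e ℤ.- c ℤ.* h ℤ.+ d ℤ.* g ≡
      (a ℤ.* f ℤ.- b ℤ.* e) ℤ.- (c ℤ.* h ℤ.- d ℤ.* g)
    expand = solve-∀

  det-⊡-sl₂ : ∀ M (A : SL₂Matrix q) → det q (M ⊡ matrix A) ≈ det q M
  det-⊡-sl₂ M A = trans (det-⊡ M (matrix A))
    (trans (*-congˡ {det q M} (det≈1 A)) (*-identityʳ (det q M)))

  ·-inverseʳ : ∀ (A : SL₂Matrix q) u → (u · matrix A) · matrix (A SL.⁻¹) ≋ u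
  ·-inverseʳ A u = ≋-trans (·-assoc u (matrix A) (matrix (A SL.⁻¹)))
    (≋-trans (·-congʳ u (SL.inverseʳ A)) (·-identityʳ u))

  ·-inverseˡ : ∀ (A : SL₂Matrix q) u → (u · matrix (A SL.⁻¹)) · matrix A ≋ u
  ·-inverseˡ A u = ≋-trans (·-assoc u (matrix (A SL.⁻¹)) (matrix A))
    (≋-trans (·-congʳ u (SL.inverseˡ A)) (·-identityʳ u))

  -- Block-diagonal isometries

  blocks : SL₂Matrix q → SL₂Matrix q → V → V
  blocks A B v = left v · matrix A ++ right v · matrix B

  blocks-isIsometry : ∀ A B → IsIsometry (blocks A B)
  blocks-isIsometry A B = record
    { isLinear = record
      { cong = λ {u} {v} u≋v → ≋-halves (blocks A B u) (blocks A B v)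
          (entries (·-congˡ {u = left u} {left v} (matrix A) (u≋v ∘ (_↑ˡ 2))))
          (entries (·-congˡ {u = right u} {right v} (matrix B) (u≋v ∘ (2 ↑ʳ_))))
      ; +-homo = λ u v → ≋-halves (blocks A B (u +ᵥ v)) (blocks A B u +ᵥ blocks A B v)
          (entries (+ᵥ-· (left u) (left v) (matrix A))) (entries (+ᵥ-· (right u) (right v) (matrix B)))
      ; *-homo = λ c v → ≋-halves (blocks A B (c *ᵥ v)) (c *ᵥ blocks A B v)
          (entries (*ᵥ-· c (left v) (matrix A))) (entries (*ᵥ-· c (right v) (matrix B)))
      }
    -- With `x` and `y` stacked as rows, the map multiplies the two 2 × 2 halves on the right by `A`
    -- and `B`, which leaves both determinants unchanged.
    ; form-homo = λ x y → let M = x ∷ y ∷ [] in begin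
        form (blocks A B x) (blocks A B y)
          ≈⟨ form-det (blocks A B x ∷ blocks A B y ∷ []) ⟩
        det q (left ∘ M ⊡ matrix A) - det q (right ∘ M ⊡ matrix B)
          ≈⟨ +-cong (det-⊡-sl₂ (left ∘ M) A) (-‿cong (det-⊡-sl₂ (right ∘ M) B)) ⟩
        det q (left ∘ M) - det q (right ∘ M)
          ≈⟨ form-det M ⟨
        form x y ∎
    }

  diagonal : SL₂Matrix q → SL₂Matrix q → Isometry
  diagonal A B = record
    { to   = blocks A B
    ; from = blocks (A SL.⁻¹) (B SL.⁻¹)
    ; to-isIsometry   = blocks-isIsometry A B
    ; from-isIsometry = blocks-isIsometry (A SL.⁻¹) (B SL.⁻¹)
    ; to-from = λ v → ≋-halves _ v (entries (·-inverseˡ A (left v))) (entries (·-inverseˡ B (right v)))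
    ; from-to = λ v → ≋-halves _ v (entries (·-inverseʳ A (left v))) (entries (·-inverseʳ B (right v)))
    }

  -- Graphs

  graph : SL₂Matrix q → Subspace 4
  graph A = rowSpace [ I ∣ matrix A ]

  left-graph : ∀ c (A : SL₂Matrix q) → left (c · [ I ∣ matrix A ]) ≋ c
  left-graph c A 0F = ·-identityʳ c 0F
  left-graph c A 1F = ·-identityʳ c 1F

  right-graph : ∀ c (A : SL₂Matrix q) → right (c · [ I ∣ matrix A ]) ≋ c · matrix A
  right-graph c A 0F = refl
  right-graph c A 1F = refl

  -- Since the left block is the identity, the coefficients of a vector in the row space are its
  -- left half.
  ∈-graph⁺ : ∀ (A : SL₂Matrix q) v → right v ≋ left v · matrix A → v ∈ Member (graph A)
  ∈-graph⁺ A v eq = left v , ≋-halves v (left v · [ I ∣ matrix A ])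
    (entries (≋-sym (left-graph (left v) A)))
    (entries {right v} (≋-trans eq (≋-sym (right-graph (left v) A))))

  ∈-graph⁻ : ∀ (A : SL₂Matrix q) v → v ∈ Member (graph A) → right v ≋ left v · matrix A
  ∈-graph⁻ A v (c , eq) =
    ≋-trans (eq ∘ (2 ↑ʳ_))
    (≋-trans (right-graph c A)
    (·-congˡ {u = c} {left v} (matrix A)
      (≋-trans (≋-sym (left-graph c A)) (≋-sym {x = left v} (eq ∘ (_↑ˡ 2))))))

  -- The halves of `u ++ w` reduce to `u` and `w` only at concrete indices, so the equation is
  -- passed on index by index.
  ++∈-graph⁺ : ∀ (A : SL₂Matrix q) u w → w ≋ u · matrix A → u ++ w ∈ Member (graph A)
  ++∈-graph⁺ A u w eq = ∈-graph⁺ A (u ++ w) λ { 0F → eq 0F ; 1F → eq 1F }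

  ++∈-graph⁻ : ∀ (A : SL₂Matrix q) u w → u ++ w ∈ Member (graph A) → w ≋ u · matrix A
  ++∈-graph⁻ A u w u++w∈ = λ { 0F → eq 0F ; 1F → eq 1F }
    where
    eq : right (u ++ w) ≋ left (u ++ w) · matrix A
    eq = ∈-graph⁻ A (u ++ w) u++w∈

  span-≤ : ∀ (L : Subspace 4) p → p ∈ Member L → rowSpace {k = 1} (λ _ → p) ≤ₛ L
  span-≤ L p p∈ (c , eq) = Subspace.resp L
    (≋-sym (≋-trans eq (single-row-· c (λ _ → p)))) (Subspace.*-closed L (c 0F) p∈)

  ·-∙ : ∀ (u : Vector Carrier 2) A B C →
        u · matrix (A SL.∙ B SL.∙ C) ≋ ((u · matrix A) · matrix B) · matrix C
  ·-∙ u A B C = ≋-sym (≋-trans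
    (·-congˡ {u = (u · matrix A) · matrix B} {u · matrix (A SL.∙ B)} (matrix C)
      (·-assoc u (matrix A) (matrix B)))
    (·-assoc u (matrix (A SL.∙ B)) (matrix C)))

  -- For v = (u , w) the two sides read w B = u A C and w = u A C B⁻¹; multiplication by B or B⁻¹ on
  -- the right passes between them.
  blocks⁻¹-graph : ∀ A B C v →
    (blocks A B v ∈ Member (graph C)) ⇔ (v ∈ Member (graph (A SL.∙ C SL.∙ B SL.⁻¹)))
  blocks⁻¹-graph A B C v = mk⇔
    (λ bv∈ → ∈-graph⁺ ACB⁻¹ v
      (≋-trans (≋-sym (·-inverseʳ B (right v)))
      (≋-trans (·-congˡ {u = right v · matrix B} {uAC} (matrix (B SL.⁻¹)) (++∈-graph⁻ C _ _ bv∈))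
      (≋-sym (·-∙ (left v) A C (B SL.⁻¹))))))
    (λ v∈ → ++∈-graph⁺ C (left v · matrix A) (right v · matrix B)
      (≋-trans (·-congˡ {u = right v} {uAC · matrix (B SL.⁻¹)} (matrix B)
                 (≋-trans (∈-graph⁻ ACB⁻¹ v v∈) (·-∙ (left v) A C (B SL.⁻¹))))
      (·-inverseˡ B uAC)))
    where
    ACB⁻¹ = A SL.∙ C SL.∙ B SL.⁻¹
    uAC = (left v · matrix A) · matrix C

  -- `image` tests membership through `from`, which is built from A⁻¹ and B⁻¹; hence the double
  -- inverse of `B`.
  image-graph : ∀ A B C →
    Isometry.image (diagonal A B) (graph C) ≈ₛ graph (A SL.⁻¹ SL.∙ C SL.∙ B SL.⁻¹ SL.⁻¹)
  image-graph A B C =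
    (λ {v} → Equivalence.to   (blocks⁻¹-graph (A SL.⁻¹) (B SL.⁻¹) C v)) ,
    (λ {v} → Equivalence.from (blocks⁻¹-graph (A SL.⁻¹) (B SL.⁻¹) C v))

  image-flip-graph : ∀ A B C →
    Isometry.image (flip (diagonal A B)) (graph C) ≈ₛ graph (A SL.∙ C SL.∙ B SL.⁻¹)
  image-flip-graph A B C =
    (λ {v} → Equivalence.to   (blocks⁻¹-graph A B C v)) ,
    (λ {v} → Equivalence.from (blocks⁻¹-graph A B C v))

-- Graphs as lines, and transversal vectors, when 1 and 0 differ

module Nontrivial (q : ℕ) (q≢1 : q ≢ 1) where

  open CommutativeRing (𝔽 q) hiding (zero)
  open LinearAlgebra (𝔽 q)
  open MatrixAction (𝔽 q)
  open W₃ q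
  open Unary using (_∈_)
  open Vec using ([]; _∷_)
  open Geometry q
  open SL₂Matrix
  open SetoidReasoning setoid
  open GroupProperties +-group using (x∙y⁻¹≈ε⇒x≈y)

  1≉0 : ¬ 1# ≈ 0#
  1≉0 (mod q∣1) = q≢1 (ℕ.∣1⇒≡1 (ℤ.∣⇒∣ᵤ q∣1))

  _≋0? : ∀ (v : Vector Carrier n) → Dec (v ≋ 0ᵥ)
  v ≋0? = all? λ i → map′ mod _≈[mod]_.divisible (+ q ℤ.∣? (v i - 0#))

  +ᵥ-≉0ˡ : ∀ (u v : Vector Carrier n) → ¬ u ≋ 0ᵥ → v ≋ 0ᵥ → ¬ u +ᵥ v ≋ 0ᵥ
  +ᵥ-≉0ˡ u v u≉0 v≋0 u+v≋0 = u≉0 λ i →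
    trans (sym (+-identityʳ (u i))) (trans (+-congˡ {u i} (sym (v≋0 i))) (u+v≋0 i))

  +ᵥ-≉0ʳ : ∀ (u v : Vector Carrier n) → u ≋ 0ᵥ → ¬ v ≋ 0ᵥ → ¬ u +ᵥ v ≋ 0ᵥ
  +ᵥ-≉0ʳ u v u≋0 v≉0 u+v≋0 =
    +ᵥ-≉0ˡ v u v≉0 u≋0 λ i → trans (+-comm (v i) (u i)) (u+v≋0 i)

  graph-independent : ∀ (A : SL₂Matrix q) → RowsIndependent [ I ∣ matrix A ]
  graph-independent A c eq = ≋-trans (≋-sym (left-graph c A)) (eq ∘ (_↑ˡ 2))

  -- The right halves of two vectors in the graph are their left halves times `A`, so both halves
  -- have the same determinant and the form vanishes.
  graph-isotropic : ∀ A → TotallyIsotropic (graph A)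
  graph-isotropic A {x} {y} x∈ y∈ = begin
    form x y
      ≈⟨ form-det M ⟩
    d - det q (right ∘ M)
      ≈⟨ +-congˡ {d} (-‿cong (det-cong (right ∘ M) (left ∘ M ⊡ matrix A) right≋)) ⟩
    d - det q (left ∘ M ⊡ matrix A)
      ≈⟨ +-congˡ {d} (-‿cong (det-⊡-sl₂ (left ∘ M) A)) ⟩
    d - d
      ≈⟨ -‿inverseʳ d ⟩
    0# ∎
    where
    M : Matrix 2 4
    M = x ∷ y ∷ []
    d = det q (left ∘ M)
    right≋ : ∀ i → right (M i) ≋ (left ∘ M ⊡ matrix A) i
    right≋ 0F = ∈-graph⁻ A x x∈
    right≋ 1F = ∈-graph⁻ A y y∈

  graph-isLine : ∀ A → IsLine (graph A)
  graph-isLine A = ([ I ∣ matrix A ] , graph-independent A , ≐-refl) ,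
                   λ {x} {y} → graph-isotropic A {x} {y}

  -- A rank one matrix has determinant zero, whereas I does not.
  graph-¬isPoint : ∀ A → ¬ IsPoint (graph A)
  graph-¬isPoint A (B , _ , A≤B , _) = 1≉0 (begin
    1#          ≈⟨ det-cong I outer row≋ ⟩
    det q outer ≈⟨ reflexive (vanish (c 0F) (c 1F) (B 0F 0F) (B 0F 1F)) ⟩
    0#          ∎)
    where
    row : Matrix 2 4
    row = [ I ∣ matrix A ]
    c : Vector Carrier 2
    c i = proj₁ (A≤B (∈-rowSpace row i)) 0F
    outer : Matrix 2 2
    outer i j = c i * left (B 0F) j
    row≋ : ∀ i → I i ≋ outer i
    row≋ i = ≋-trans (≋-sym (left-graph (I i) A))
      (≋-trans (I-·ˡ row i ∘ (_↑ˡ 2))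
      (λ j → trans (proj₂ (A≤B (∈-rowSpace row i)) (j ↑ˡ 2))
                   (single-row-· (proj₁ (A≤B (∈-rowSpace row i))) B (j ↑ˡ 2))))
    vanish : ∀ a b x y → (a ℤ.* x) ℤ.* (b ℤ.* y) ℤ.- (a ℤ.* y) ℤ.* (b ℤ.* x) ≡ + 0
    vanish = solve-∀

  graph-left≉0 : ∀ A v → v ∈ Member (graph A) → ¬ v ≋ 0ᵥ → ¬ left v ≋ 0ᵥ
  graph-left≉0 A v v∈ v≉0 left≋0 = v≉0 (≋-halves v 0ᵥ (entries left≋0) (entries {right v}
    (≋-trans (∈-graph⁻ A v v∈)
    (≋-trans (·-congˡ {u = left v} (matrix A) left≋0) (0ᵥ-· (matrix A))))))

  graph-right≉0 : ∀ A v → v ∈ Member (graph A) → ¬ left v ≋ 0ᵥ → ¬ right v ≋ 0ᵥ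
  graph-right≉0 A v v∈ left≉0 right≋0 = left≉0
    (≋-trans (≋-sym (·-inverseʳ A (left v)))
    (≋-trans (·-congˡ {u = left v · matrix A} (matrix (A SL.⁻¹))
               (≋-trans (≋-sym (∈-graph⁻ A v v∈)) right≋0))
    (0ᵥ-· (matrix (A SL.⁻¹)))))

  graph-cong : ∀ {A B} → A SL.≈ B → graph A ≈ₛ graph B
  graph-cong {A} {B} A≈B = ⊆ A B A≈B , ⊆ B A (SL.sym {A} {B} A≈B)
    where
    ⊆ : ∀ A B → A SL.≈ B → graph A ≤ₛ graph B
    ⊆ A B A≈B {v} v∈ = ∈-graph⁺ B v (≋-trans (∈-graph⁻ A v v∈) (·-congʳ (left v) A≈B))

  -- Vectors of an isotropic line with both halves nonzero

  det-zero : ∀ (M : Matrix 2 2) → (∀ i → M i ≋ 0ᵥ) → det q M ≈ 0#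
  det-zero M M≋0 = det-cong M (λ _ → 0ᵥ) M≋0

  -- Row `i` holds coefficients for which the rows of `M` cancel in column `i`; in the other column
  -- they give the determinant up to sign. For a singular matrix both rows are thus linear
  -- relations.
  syzygy : Matrix 2 2 → Matrix 2 2
  syzygy M i = M 1F i ∷ - M 0F i ∷ []

  syzygy-· : ∀ M → det q M ≈ 0# → ∀ i → syzygy M i · M ≋ 0ᵥ
  syzygy-· M det≈0 = λ where
      0F 0F → reflexive (same a c)
      0F 1F → trans (reflexive (negated a b c d)) (-‿cong det≈0)
      1F 0F → trans (reflexive (plain a b c d)) det≈0
      1F 1F → reflexive (same b d)
    where
    a = M 0F 0F
    b = M 0F 1F
    c = M 1F 0F
    d = M 1F 1F
    same : ∀ a c → c ℤ.* a ℤ.+ ((ℤ.- a) ℤ.* c ℤ.+ + 0) ≡ + 0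
    same = solve-∀
    negated : ∀ a b c d → c ℤ.* b ℤ.+ ((ℤ.- a) ℤ.* d ℤ.+ + 0) ≡ ℤ.- (a ℤ.* d ℤ.- b ℤ.* c)
    negated = solve-∀
    plain : ∀ a b c d → d ℤ.* a ℤ.+ ((ℤ.- b) ℤ.* c ℤ.+ + 0) ≡ a ℤ.* d ℤ.- b ℤ.* c
    plain = solve-∀

  module _ (M : Matrix 2 4) (independent : RowsIndependent M)
           (isotropic : form (M 0F) (M 1F) ≈ 0#) where

    private
      dets≈ : det q (left ∘ M) ≈ det q (right ∘ M)
      dets≈ = x∙y⁻¹≈ε⇒x≈y _ _ (trans (sym (form-det M)) isotropic)

    -- If both left halves vanished, isotropy would make the right block singular. Its syzygies
    -- would then annihilate all of `M`, so independence would make their coefficients zero.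
    left-rows≉0 : ¬ (∀ i → left (M i) ≋ 0ᵥ)
    left-rows≉0 left≋0 = independent⇒row≉0 1≉0 M independent 1F
      (≋-halves (M 1F) 0ᵥ (entries (left≋0 1F)) (row 0F , row 1F))
      where
      det≈0 : det q (right ∘ M) ≈ 0#
      det≈0 = trans (sym dets≈) (det-zero (left ∘ M) left≋0)
      row : ∀ i → right (M 1F) i ≈ 0#
      row i = independent (syzygy (right ∘ M) i)
        (≋-halves (syzygy (right ∘ M) i · M) 0ᵥ
          (entries (·-zeroʳ (syzygy (right ∘ M) i) (left ∘ M) left≋0))
          (entries (syzygy-· (right ∘ M) det≈0 i)))
        -- Coefficient 0 of the `i`-th syzygy is entry `i` of the second row, which is therefore
        -- zero.
        0F

    right-rows≉0 : ¬ (∀ i → right (M i) ≋ 0ᵥ)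
    right-rows≉0 right≋0 = independent⇒row≉0 1≉0 M independent 1F
      (≋-halves (M 1F) 0ᵥ (row 0F , row 1F) (entries (right≋0 1F)))
      where
      det≈0 : det q (left ∘ M) ≈ 0#
      det≈0 = trans dets≈ (det-zero (right ∘ M) right≋0)
      row : ∀ i → left (M 1F) i ≈ 0#
      row i = independent (syzygy (left ∘ M) i)
        (≋-halves (syzygy (left ∘ M) i · M) 0ᵥ
          (entries (syzygy-· (left ∘ M) det≈0 i))
          (entries (·-zeroʳ (syzygy (left ∘ M) i) (right ∘ M) right≋0)))
        0F

  Transversal : V → Set
  Transversal v = ¬ left v ≋ 0ᵥ × ¬ right v ≋ 0ᵥ

  -- If neither basis row is transversal, each has a zero half. These halves lie on opposite sides,
  -- because the rows cannot both vanish on the same side; so the sum of the rows is transversal.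
  line-transversal : ∀ L → IsLine L → ∃[ p ] p ∈ Member L × Transversal p
  line-transversal L ((M , independent , L≈M) , isotropic) = search
    where
    row∈ : ∀ i → M i ∈ Member L
    row∈ i = proj₂ L≈M (∈-rowSpace M i)
    left≉0 : left (M 0F) ≋ 0ᵥ → ¬ left (M 1F) ≋ 0ᵥ
    left≉0 p r = left-rows≉0 M independent (isotropic (row∈ 0F) (row∈ 1F))
      λ { 0F → p ; 1F → r }
    right≉0 : right (M 0F) ≋ 0ᵥ → ¬ right (M 1F) ≋ 0ᵥ
    right≉0 p r = right-rows≉0 M independent (isotropic (row∈ 0F) (row∈ 1F))
      λ { 0F → p ; 1F → r }
    sum∈ : M 0F +ᵥ M 1F ∈ Member L
    sum∈ = Subspace.+-closed L (row∈ 0F) (row∈ 1F)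
    search : ∃[ p ] p ∈ Member L × Transversal p
    search with left (M 0F) ≋0? | right (M 0F) ≋0? | left (M 1F) ≋0? | right (M 1F) ≋0?
    ... | no l | no r | _ | _ = M 0F , row∈ 0F , l , r
    ... | _ | _ | no l | no r = M 1F , row∈ 1F , l , r
    ... | yes l₀ | _ | yes l₁ | _ = contradiction l₁ (left≉0 l₀)
    ... | _ | yes r₀ | _ | yes r₁ = contradiction r₁ (right≉0 r₀)
    ... | yes l₀ | no r₀ | no l₁ | yes r₁ =
      M 0F +ᵥ M 1F , sum∈ ,
      +ᵥ-≉0ʳ (left (M 0F)) (left (M 1F)) l₀ l₁ , +ᵥ-≉0ˡ (right (M 0F)) (right (M 1F)) r₀ r₁
    ... | no l₀ | yes r₀ | yes l₁ | no r₁ =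
      M 0F +ᵥ M 1F , sum∈ ,
      +ᵥ-≉0ˡ (left (M 0F)) (left (M 1F)) l₀ l₁ , +ᵥ-≉0ʳ (right (M 0F)) (right (M 1F)) r₀ r₁

  -- A generator of the point is nonzero and of the form (u , u A), so u is nonzero, and u A is
  -- nonzero because `A` is invertible.
  point-on-graph : ∀ {P L} A → L ≈ₛ graph A → PointOnLine P L →
    ∃[ p ] P ≈ₛ rowSpace {k = 1} (λ _ → p) × p ∈ Member (graph A) × Transversal p
  point-on-graph {P} {L} A L≈A ((B , independent , P≈B) , _ , P≤L) =
    B 0F , ≐-trans P≈B (rowSpace-cong B (λ _ → B 0F) λ { 0F → ≋-refl }) , p∈ , l ,
    graph-right≉0 A (B 0F) p∈ l
    where
    p∈ : B 0F ∈ Member (graph A)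
    p∈ = proj₁ L≈A (P≤L (proj₂ P≈B (∈-rowSpace B 0F)))
    l : ¬ left (B 0F) ≋ 0ᵥ
    l = graph-left≉0 A (B 0F) p∈ (independent⇒row≉0 1≉0 B independent 0F)

  -- Maximality and neighbour-transitivity of the code of `G`

  module _ (G : Subgroup (SL₂ q)) (sharplyTransitive : SharplyTransitive q G) where

    open Subgroup G using () renaming
      (Member to 𝒢; ∙-closed to 𝒢-∙; ⁻¹-closed to 𝒢-⁻¹)

    -- Moving u to the first unit vector replaces division by a coordinate of u.
    *ᵥ-cancel : ∀ c (u : Vector Carrier 2) → ¬ u ≋ 0ᵥ → c *ᵥ u ≋ 0ᵥ → c ≈ 0#
    *ᵥ-cancel c u u≉0 cu≋0 = begin
      c                      ≈⟨ *-identityʳ c ⟨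
      c * 1#                 ≈⟨ *-congˡ {c} (u·A≋e₁ 0F) ⟨
      c * (u · matrix A) 0F  ≈⟨ *ᵥ-· c u (matrix A) 0F ⟨
      (c *ᵥ u · matrix A) 0F ≈⟨ ·-congˡ {u = c *ᵥ u} (matrix A) cu≋0 0F ⟩
      (0ᵥ · matrix A) 0F     ≈⟨ 0ᵥ-· (matrix A) 0F ⟩
      0#                     ∎
      where
      e₁ : Vector Carrier 2
      e₁ = I 0F
      solution = sharplyTransitive u e₁ u≉0 (λ e₁≋0 → 1≉0 (e₁≋0 0F))
      A = proj₁ solution
      u·A≋e₁ : u · matrix A ≋ e₁
      u·A≋e₁ = proj₂ (proj₁ (proj₂ solution))

    span-isPoint : ∀ p → ¬ left p ≋ 0ᵥ → IsPoint (rowSpace {k = 1} λ _ → p)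
    span-isPoint p l = (λ _ → p) ,
      -- Cancellation is available for vectors of length two, so it is applied to the left half.
      (λ { c eq 0F → *ᵥ-cancel (c 0F) (left p) l λ i →
           trans (sym (single-row-· c (λ _ → p) (i ↑ˡ 2))) (eq (i ↑ˡ 2)) }) ,
      ≐-refl

    -- Both matrices carry the left half of `p` to its right half; the uniqueness in sharp
    -- transitivity identifies them.
    agree-on : ∀ {A B} → A ∈ 𝒢 → B ∈ 𝒢 → ∀ p → Transversal p →
               p ∈ Member (graph A) → p ∈ Member (graph B) → A SL.≈ B
    agree-on {A} {B} A∈ B∈ p (l , r) p∈A p∈B =
      let C , _ , unique = sharplyTransitive (left p) (right p) l r in
      SL.trans {A} {C} {B}
        (SL.sym {C} {A} (unique {A} (A∈ , ≋-sym (∈-graph⁻ A p p∈A))))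
        (unique {B} (B∈ , ≋-sym (∈-graph⁻ B p p∈B)))

    isPartialSpread : IsPartialSpread (rowSpaces G)
    isPartialSpread = record
      { resp     = λ L≈M (A , A∈ , L≈A) → A , A∈ , ≐-trans (≐-sym L≈M) L≈A
      ; lines    = λ {L} (A , _ , L≈A) → IsLine-resp {graph A} {L} (≐-sym L≈A) (graph-isLine A)
      ; disjoint = λ {P} {L} {M} (A , A∈ , L≈A) (B , B∈ , M≈B) P∈L (_ , _ , P≤M) →
          let p , P≈p , p∈A , transversal = point-on-graph {P} {L} A L≈A P∈L
              p∈B = proj₁ M≈B (P≤M (proj₂ P≈p (∈-rowSpace {k = 1} (λ _ → p) 0F)))
          in ≐-trans L≈A
             (≐-trans (graph-cong {A} {B} (agree-on A∈ B∈ p transversal p∈A p∈B))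
             (≐-sym M≈B))
      }

    isMaximal : IsMaximalPartialSpread (rowSpaces G)
    isMaximal = isPartialSpread , λ T T-spread S⊆T {L} L∈T →
      let module T = IsPartialSpread T-spread
          p , p∈L , l , r = line-transversal L (T.lines L∈T)
          -- Existence in sharp transitivity puts `p` on the graph of some `A` in `G`. That graph is
          -- in `T` and shares the point spanned by `p` with `L`, so `L` equals it.
          A , (A∈ , u·A≋w) , _ = sharplyTransitive (left p) (right p) l r
          P = rowSpace {k = 1} (λ _ → p)
          isPoint = span-isPoint p l
      in A , A∈ , T.disjoint {P} {L} {graph A} L∈T (S⊆T (A , A∈ , ≐-refl))
           (isPoint , T.lines L∈T , λ {v} → span-≤ L p p∈L {v})
           (isPoint , graph-isLine A , λ {v} → span-≤ (graph A) p (∈-graph⁺ A p (≋-sym u·A≋w)) {v})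

    -- `C` is sent to A⁻¹ C B, which stays in `G`; the converse applies the inverse isometry, which
    -- sends `C` to A C B⁻¹.
    diagonal-stabilises : ∀ {A B} → A ∈ 𝒢 → B ∈ 𝒢 →
      Stabilises (code (rowSpaces G)) (automorphism (diagonal A B))
    diagonal-stabilises {A} {B} A∈ B∈ x = mk⇔
      (λ (C , C∈ , x≈C) →
        A SL.⁻¹ SL.∙ C SL.∙ B SL.⁻¹ SL.⁻¹ ,
        𝒢-∙ (𝒢-∙ (𝒢-⁻¹ A∈) C∈) (𝒢-⁻¹ (𝒢-⁻¹ B∈)) ,
        ≐-trans (Φ.image-cong {subspace x} {graph C} x≈C) (image-graph A B C))
      (λ (C , C∈ , φx≈C) →
        A SL.∙ C SL.∙ B SL.⁻¹ ,
        𝒢-∙ (𝒢-∙ A∈ C∈) (𝒢-⁻¹ B∈) ,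
        ≐-trans (≐-sym (image-flip (diagonal A B) (subspace x)))
          (≐-trans (Ψ.image-cong {Φ.image (subspace x)} {graph C} φx≈C) (image-flip-graph A B C)))
      where
      module Φ = Isometry (diagonal A B)
      module Ψ = Isometry (flip (diagonal A B))

    -- (u , w) ↦ (u A , w B) maps the graph of C to that of A⁻¹ C B, hence A to B.
    transitiveOnCode : StabiliserTransitiveOn (code (rowSpaces G)) (code (rowSpaces G))
    transitiveOnCode x y (A , A∈ , x≈A) (B , B∈ , y≈B) =
      automorphism (diagonal A B) , diagonal-stabilises A∈ B∈ ,
      ≐-trans (Isometry.image-cong (diagonal A B) {subspace x} {graph A} x≈A)
      (≐-trans (image-graph A B A)
      (≐-trans (graph-cong {A SL.⁻¹ SL.∙ A SL.∙ B SL.⁻¹ SL.⁻¹} {B} A⁻¹AB≈B) (≐-sym y≈B)))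
      where
      A⁻¹AB≈B : A SL.⁻¹ SL.∙ A SL.∙ B SL.⁻¹ SL.⁻¹ SL.≈ B
      A⁻¹AB≈B = SL.trans {A SL.⁻¹ SL.∙ A SL.∙ B SL.⁻¹ SL.⁻¹} {SL.ε SL.∙ B} {B}
        (SL.∙-cong {A SL.⁻¹ SL.∙ A} {SL.ε} {B SL.⁻¹ SL.⁻¹} {B}
          (SL.inverseˡ A) (GroupProperties.⁻¹-involutive (SL₂ q) B))
        (SL.identityˡ B)

    -- Members of the code are lines and not points, so a neighbour can only be a point on one of
    -- them.
    neighbour-span : ∀ x → x ∈ Neighbours (code (rowSpaces G)) →
      ∃[ p ] subspace x ≈ₛ rowSpace {k = 1} (λ _ → p) × Transversal p
    neighbour-span x (_ , u , (A , _ , u≈A) , inj₁ (u-isPoint , _)) = contradiction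
      (HasDimension-resp {U = subspace u} {graph A} u≈A u-isPoint) (graph-¬isPoint A)
    neighbour-span x (_ , u , (A , _ , u≈A) , inj₂ x∈u) =
      let p , x≈p , _ , transversal = point-on-graph {subspace x} {subspace u} A u≈A x∈u
      in p , x≈p , transversal

    transitiveOnNeighbours :
      StabiliserTransitiveOn (code (rowSpaces G)) (Neighbours (code (rowSpaces G)))
    transitiveOnNeighbours x y x∈ y∈ =
      let p , x≈p , lp , rp = neighbour-span x x∈
          r , y≈r , lr , rr = neighbour-span y y∈
          -- The two halves are moved independently, `A` acting on the left and `B` on the right.
          A , (A∈ , pA≋r) , _ = sharplyTransitive (left p) (left r) lp lr
          B , (B∈ , pB≋r) , _ = sharplyTransitive (right p) (right r) rp rr
          module Φ = Isometry (diagonal A B)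
          span = λ v → rowSpace {k = 1} (λ _ → v)
      in automorphism (diagonal A B) , diagonal-stabilises A∈ B∈ ,
         ≐-trans (Φ.image-cong {subspace x} {span p} x≈p)
         (≐-trans (Φ.image-rowSpace {1} (λ _ → p))
         (≐-trans (rowSpace-cong {1} (λ _ → blocks A B p) (λ _ → r)
                    (λ _ → ≋-halves (blocks A B p) r
                      (entries {left p · matrix A} pA≋r) (entries {right p · matrix B} pB≋r)))
         (≐-sym y≈r)))

open import Data.List.Base using ([]; _∷_)
open import Data.List.Membership.Propositional using (_∈_)

lemma5p5 : ∀ (q : ℕ) → q ∈ 2 ∷ 3 ∷ 5 ∷ 7 ∷ 11 ∷ [] →
    ∀ (G : Subgroup (SL₂ q)) → SharplyTransitive q G →
    (q ≡ 2 → Subgroup.group G ≅ GL₁ 𝔽₄) →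
    (q ≡ 3 → Subgroup.group G ≅ Q₈) →
    (q ≡ 5 → Subgroup.group G IsDoubleCoverOf Subgroup.group (Alt 4)) →
    (q ≡ 7 → Subgroup.group G IsDoubleCoverOf Sym 4) →
    (q ≡ 11 → Subgroup.group G ≅ SL₂ 5) →
    W₃.IsMaximalPartialSpread q (W₃.rowSpaces q G) ×
    W₃.NeighbourTransitive q (W₃.code q (W₃.rowSpaces q G))
lemma5p5 q q∈ G sharplyTransitive _ _ _ _ _ =
  isMaximal G sharplyTransitive ,
  transitiveOnCode G sharplyTransitive , transitiveOnNeighbours G sharplyTransitive
  where
  -- This ensures that 1 and 0 differ modulo `q`; it is checked for each of the five primes.
  q≢1 : q ≢ 1
  q≢1 = All.lookup {P = _≢ 1}
    ((λ ()) All.∷ (λ ()) All.∷ (λ ()) All.∷ (λ ()) All.∷ (λ ()) All.∷ All.[]) q∈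
  open Nontrivial q q≢1
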